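{- Let $p$ be a large prime, let $k$ be a positive integer, let $N$ be an integer with $2\le N<p$, and let $I=[1,N]$. Then the number $J_{2k}$ of solutions of the congruence $$x_1^*+\dots+x_k^*\equiv x_{k+1}^*+\dots+x_{2k}^*\pmod p,\qquad x_1,\dots,x_{2k}\in I,$$ satisfies $$J_{2k}<(2k)^{90k^3}(\log N)^{4k^2}\left(\frac{N^{2k-1}}{p}+1\right)N^{k}.$$
   Context: $[1,N]$ denotes the set of integers $1,\dots,N$. For an integer $x$ coprime to $p$, $x^*$ denotes its multiplicative inverse modulo $p$. "Large prime" means $p\ge p_0$ for some absolute constant $p_0$ (independent of $k$ and $N$). -}

module Defs where

open import Data.Fin.Base using (Fin; toℕ; fromℕ<)
open import Data.Fin.Properties using (any?; toℕ-fromℕ<)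
open import Data.Integer.Base as ℤ using (+_)
import Data.Integer.Properties as ℤ
open import Data.List.Base using (List; []; _∷_; [_]; map; upTo; filter; length; cartesianProductWith)
open import Data.Nat.Base as ℕ using (ℕ; zero; suc)
open import Data.Nat.Coprimality using (Coprime; coprime-Bézout)
open import Data.Nat.DivMod using (m%n<n; m%n%n≡m%n; [m+n]%n≡m%n; [m+kn]%n≡m%n; %-distribˡ-*)
open import Data.Nat.GCD using (module Bézout)
import Data.Nat.Properties as ℕ
open import Data.Nat.Tactic.RingSolver using (solve-∀)
open import Data.Product.Base using (∃-syntax; _×_; _,_; proj₁; proj₂)
open import Data.Rational.Base as ℚ
  using (ℚ; mkℚ; 0ℚ; 1ℚ; _/_; _+_; _*_; _-_; -_; _≤_; _<_; ∣_∣; 1/_)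
import Data.Rational.Properties as ℚ
open import Data.Rational.Unnormalised.Base
  using (mkℚᵘ; *≡*; *≤*) renaming (_/_ to _/ᵘ_; _≃_ to _≃ᵘ_; _≤_ to _≤ᵘ_)
import Data.Rational.Unnormalised.Properties as ℚᵘ
open import Data.Rational.Solver using (module +-*-Solver)
open import Data.Sum.Base using (inj₁; inj₂)
open import Data.Vec.Base as Vec using (Vec; []; _∷_)
open import Relation.Binary.PropositionalEquality
  using (_≡_; refl; sym; trans; cong; subst; subst₂; module ≡-Reasoning)
open import Relation.Nullary.Decidable using (yes; no)
open import Relation.Nullary.Negation using (contradiction)
open import Relation.Unary using (Decidable)

infix 4 _≡_[mod_] _<ℝ_
infixl 7 _*ℝ_
infixr 8 _^ℝ_ _^ℚ_

_≡_[mod_] : ℕ → ℕ → (m : ℕ) .{{_ : ℕ.NonZero m}} → Set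
a ≡ b [mod m ] = a ℕ.% m ≡ b ℕ.% m

-- The value 0 is only taken when x is not invertible modulo p;
-- see inverse-correct.

inverse : (p : ℕ) .{{_ : ℕ.NonZero p}} → ℕ → ℕ
inverse p x with any? (λ (y : Fin p) → (x ℕ.* toℕ y) ℕ.% p ℕ.≟ 1 ℕ.% p)
... | yes (y , _) = toℕ y
... | no  _       = 0

private

  reduce-mod : ∀ p .{{_ : ℕ.NonZero p}} x y →
               x ℕ.* y ≡ 1 [mod p ] → x ℕ.* (y ℕ.% p) ≡ 1 [mod p ]
  reduce-mod p x y xy≡1 = begin
    (x ℕ.* (y ℕ.% p)) ℕ.% p                     ≡⟨ %-distribˡ-* x (y ℕ.% p) p ⟩
    ((x ℕ.% p) ℕ.* (y ℕ.% p ℕ.% p)) ℕ.% p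
      ≡⟨ cong (λ z → ((x ℕ.% p) ℕ.* z) ℕ.% p) (m%n%n≡m%n y p) ⟩
    ((x ℕ.% p) ℕ.* (y ℕ.% p)) ℕ.% p             ≡⟨ %-distribˡ-* x y p ⟨
    (x ℕ.* y) ℕ.% p                             ≡⟨ xy≡1 ⟩
    1 ℕ.% p                                     ∎
    where open ≡-Reasoning

  inverse-exists : ∀ p .{{_ : ℕ.NonZero p}} x → Coprime x p → ∃[ y ] x ℕ.* y ≡ 1 [mod p ]
  inverse-exists p@(suc q) x c with coprime-Bézout c
  ... | Bézout.+- a b 1+bp≡ax = a , (begin
    (x ℕ.* a) ℕ.% p          ≡⟨ cong (ℕ._% p) (ℕ.*-comm x a) ⟩
    (a ℕ.* x) ℕ.% p          ≡⟨ cong (ℕ._% p) 1+bp≡ax ⟨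
    (1 ℕ.+ b ℕ.* p) ℕ.% p    ≡⟨ [m+kn]%n≡m%n 1 b p ⟩
    1 ℕ.% p                  ∎)
    where open ≡-Reasoning
  ... | Bézout.-+ a b 1+ax≡bp = a ℕ.* q , (begin
    (x ℕ.* (a ℕ.* q)) ℕ.% p                    ≡⟨ [m+n]%n≡m%n (x ℕ.* (a ℕ.* q)) p ⟨
    (x ℕ.* (a ℕ.* q) ℕ.+ suc q) ℕ.% p          ≡⟨ cong (ℕ._% p) (regroup₁ x a q) ⟩
    (1 ℕ.+ (1 ℕ.+ a ℕ.* x) ℕ.* q) ℕ.% p        ≡⟨ cong (λ z → (1 ℕ.+ z ℕ.* q) ℕ.% p) 1+ax≡bp ⟩
    (1 ℕ.+ b ℕ.* suc q ℕ.* q) ℕ.% p            ≡⟨ cong (ℕ._% p) (regroup₂ b q) ⟩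
    (1 ℕ.+ b ℕ.* q ℕ.* suc q) ℕ.% p            ≡⟨ [m+kn]%n≡m%n 1 (b ℕ.* q) p ⟩
    1 ℕ.% p                                    ∎)
    where
    open ≡-Reasoning
    regroup₁ : ∀ x a q → x ℕ.* (a ℕ.* q) ℕ.+ suc q ≡ 1 ℕ.+ (1 ℕ.+ a ℕ.* x) ℕ.* q
    regroup₁ = solve-∀
    regroup₂ : ∀ b q → 1 ℕ.+ b ℕ.* suc q ℕ.* q ≡ 1 ℕ.+ b ℕ.* q ℕ.* suc q
    regroup₂ = solve-∀

inverse-correct : ∀ p .{{_ : ℕ.NonZero p}} x → Coprime x p →
                  x ℕ.* inverse p x ≡ 1 [mod p ]
inverse-correct p x c with any? (λ (y : Fin p) → (x ℕ.* toℕ y) ℕ.% p ℕ.≟ 1 ℕ.% p)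
... | yes (_ , xy≡1) = xy≡1
... | no  none =
  let y , xy≡1 = inverse-exists p x c
      y%p<p = m%n<n y p
  in contradiction
       ( fromℕ< y%p<p
       , subst (λ z → x ℕ.* z ≡ 1 [mod p ]) (sym (toℕ-fromℕ< y%p<p)) (reduce-mod p x y xy≡1))
       none

tuples : ∀ {A : Set} → List A → (n : ℕ) → List (Vec A n)
tuples xs zero    = [ [] ]
tuples xs (suc n) = cartesianProductWith _∷_ xs (tuples xs n)

interval : ℕ → List ℕ
interval N = map suc (upTo N)

sumInverses : ∀ {n} (p : ℕ) .{{_ : ℕ.NonZero p}} → Vec ℕ n → ℕ
sumInverses p xs = Vec.sum (Vec.map (inverse p) xs)

IsSolution : (p : ℕ) .{{_ : ℕ.NonZero p}} (k : ℕ) → Vec ℕ (k ℕ.+ k) → Set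
IsSolution p k x = sumInverses p (Vec.take k x) ≡ sumInverses p (Vec.drop k x) [mod p ]

isSolution? : ∀ p .{{_ : ℕ.NonZero p}} k → Decidable (IsSolution p k)
isSolution? p k x = _ ℕ.≟ _

J₂ₖ : (p : ℕ) .{{_ : ℕ.NonZero p}} (N k : ℕ) → ℕ
J₂ₖ p N k = length (filter (isSolution? p k) (tuples (interval N) (k ℕ.+ k)))

-- Reals are Cauchy sequences of rationals, compared through _<ℝ_ and
-- not through equality of the underlying sequences.

IsCauchy : (ℕ → ℚ) → Set
IsCauchy x = ∀ ε → 0ℚ < ε → ∃[ M ] ∀ m n → M ℕ.≤ m → M ℕ.≤ n → ∣ x m - x n ∣ ≤ ε

record ℝ : Set where
  constructor mkℝ
  field
    seq    : ℕ → ℚ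
    cauchy : IsCauchy seq

open ℝ public

_<ℝ_ : ℝ → ℝ → Set
x <ℝ y = ∃[ ε ] 0ℚ < ε × ∃[ M ] ∀ n → M ℕ.≤ n → seq x n + ε ≤ seq y n

fromℚ : ℚ → ℝ
fromℚ q = mkℝ (λ _ → q) λ ε 0<ε → 0 , λ _ _ _ _ →
  subst (λ z → ∣ z ∣ ≤ ε) (sym (ℚ.+-inverseʳ q)) (ℚ.<⇒≤ 0<ε)

fromℕ : ℕ → ℝ
fromℕ n = fromℚ (+ n / 1)

private

  product-cauchy : ∀ x y → IsCauchy x → IsCauchy y → IsCauchy (λ n → x n * y n)
  product-cauchy x y cx cy ε 0<ε = M , close
    where
    open ℚ.≤-Reasoning

    bound : (ℕ → ℚ) → ℕ → ℚ
    bound z M = 1ℚ + ∣ z M ∣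

    bounded : ∀ z M → (∀ m n → M ℕ.≤ m → M ℕ.≤ n → ∣ z m - z n ∣ ≤ 1ℚ) →
              ∀ n → M ℕ.≤ n → ∣ z n ∣ ≤ bound z M
    bounded z M c n M≤n = begin
      ∣ z n ∣                        ≡⟨ cong ∣_∣ (solve 2 (λ a b → a := (a :- b) :+ b) refl (z n) (z M)) ⟩
      ∣ (z n - z M) + z M ∣          ≤⟨ ℚ.∣p+q∣≤∣p∣+∣q∣ (z n - z M) (z M) ⟩
      ∣ z n - z M ∣ + ∣ z M ∣        ≤⟨ ℚ.+-monoˡ-≤ ∣ z M ∣ (c n M M≤n ℕ.≤-refl) ⟩
      1ℚ + ∣ z M ∣                   ∎
      where open +-*-Solver

    M₁ = proj₁ (cx 1ℚ (ℚ.positive⁻¹ 1ℚ))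
    M₂ = proj₁ (cy 1ℚ (ℚ.positive⁻¹ 1ℚ))
    B = bound x M₁
    C = bound y M₂
    s = B + C

    instance
      B-pos : ℚ.Positive B
      B-pos = ℚ.pos+nonNeg⇒pos 1ℚ ∣ x M₁ ∣ {{ℚ.∣-∣-nonNeg (x M₁)}}
      C-pos : ℚ.Positive C
      C-pos = ℚ.pos+nonNeg⇒pos 1ℚ ∣ y M₂ ∣ {{ℚ.∣-∣-nonNeg (y M₂)}}
      s-pos : ℚ.Positive s
      s-pos = ℚ.pos+pos⇒pos B C
      s-nonZero : ℚ.NonZero s
      s-nonZero = ℚ.pos⇒nonZero s
      ε-pos : ℚ.Positive ε
      ε-pos = ℚ.positive 0<ε

    δ = ε * 1/ s

    instance
      δ-pos : ℚ.Positive δ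
      δ-pos = ℚ.pos*pos⇒pos ε (1/ s) {{ℚ.1/pos⇒pos s}}
      δ-nonNeg : ℚ.NonNegative δ
      δ-nonNeg = ℚ.pos⇒nonNeg δ

    M₃ = proj₁ (cx δ (ℚ.positive⁻¹ δ))
    M₄ = proj₁ (cy δ (ℚ.positive⁻¹ δ))
    M  = (M₁ ℕ.⊔ M₂) ℕ.⊔ (M₃ ℕ.⊔ M₄)

    M₁≤M : M₁ ℕ.≤ M
    M₁≤M = ℕ.≤-trans (ℕ.m≤m⊔n M₁ M₂) (ℕ.m≤m⊔n (M₁ ℕ.⊔ M₂) (M₃ ℕ.⊔ M₄))
    M₂≤M : M₂ ℕ.≤ M
    M₂≤M = ℕ.≤-trans (ℕ.m≤n⊔m M₁ M₂) (ℕ.m≤m⊔n (M₁ ℕ.⊔ M₂) (M₃ ℕ.⊔ M₄))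
    M₃≤M : M₃ ℕ.≤ M
    M₃≤M = ℕ.≤-trans (ℕ.m≤m⊔n M₃ M₄) (ℕ.m≤n⊔m (M₁ ℕ.⊔ M₂) (M₃ ℕ.⊔ M₄))
    M₄≤M : M₄ ℕ.≤ M
    M₄≤M = ℕ.≤-trans (ℕ.m≤n⊔m M₃ M₄) (ℕ.m≤n⊔m (M₁ ℕ.⊔ M₂) (M₃ ℕ.⊔ M₄))

    close : ∀ m n → M ℕ.≤ m → M ℕ.≤ n → ∣ x m * y m - x n * y n ∣ ≤ ε
    close m n M≤m M≤n = begin
      ∣ x m * y m - x n * y n ∣
        ≡⟨ cong ∣_∣ (solve 4 (λ a b c d → a :* b :- c :* d := a :* (b :- d) :+ d :* (a :- c)) refl (x m) (y m) (x n) (y n)) ⟩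
      ∣ x m * (y m - y n) + y n * (x m - x n) ∣
        ≤⟨ ℚ.∣p+q∣≤∣p∣+∣q∣ (x m * (y m - y n)) (y n * (x m - x n)) ⟩
      ∣ x m * (y m - y n) ∣ + ∣ y n * (x m - x n) ∣
        ≤⟨ ℚ.+-mono-≤
             (product-≤ (x m) (y m - y n) B {{ℚ.pos⇒nonNeg B}}
               (bounded x M₁ (proj₂ (cx 1ℚ _)) m (ℕ.≤-trans M₁≤M M≤m))
               (proj₂ (cy δ _) m n (ℕ.≤-trans M₄≤M M≤m) (ℕ.≤-trans M₄≤M M≤n)))
             (product-≤ (y n) (x m - x n) C {{ℚ.pos⇒nonNeg C}}
               (bounded y M₂ (proj₂ (cy 1ℚ _)) n (ℕ.≤-trans M₂≤M M≤n))
               (proj₂ (cx δ _) m n (ℕ.≤-trans M₃≤M M≤m) (ℕ.≤-trans M₃≤M M≤n))) ⟩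
      B * δ + C * δ
        ≡⟨ solve 4 (λ b c e t → b :* (e :* t) :+ c :* (e :* t) := e :* ((b :+ c) :* t)) refl B C ε (1/ s) ⟩
      ε * (s * 1/ s)    ≡⟨ cong (ε *_) (ℚ.*-inverseʳ s) ⟩
      ε * 1ℚ            ≡⟨ ℚ.*-identityʳ ε ⟩
      ε                 ∎
      where
      open +-*-Solver
      product-≤ : ∀ a b c .{{_ : ℚ.NonNegative c}} → ∣ a ∣ ≤ c → ∣ b ∣ ≤ δ → ∣ a * b ∣ ≤ c * δ
      product-≤ a b c a≤c b≤δ = begin
        ∣ a * b ∣        ≡⟨ ℚ.∣p*q∣≡∣p∣*∣q∣ a b ⟩
        ∣ a ∣ * ∣ b ∣    ≤⟨ ℚ.*-monoʳ-≤-nonNeg ∣ b ∣ {{ℚ.∣-∣-nonNeg b}} a≤c ⟩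
        c * ∣ b ∣        ≤⟨ ℚ.*-monoˡ-≤-nonNeg c b≤δ ⟩
        c * δ            ∎

_*ℝ_ : ℝ → ℝ → ℝ
x *ℝ y = mkℝ (λ n → seq x n * seq y n) (product-cauchy (seq x) (seq y) (cauchy x) (cauchy y))

_^ℝ_ : ℝ → ℕ → ℝ
x ^ℝ zero  = fromℚ 1ℚ
x ^ℝ suc n = x *ℝ x ^ℝ n

-- The natural logarithm of a positive integer, from the series
-- - log (1 - r) = ∑ rʲ / j (j ≥ 1) at r = 1 - 1 / N.

_^ℚ_ : ℚ → ℕ → ℚ
q ^ℚ zero  = 1ℚ
q ^ℚ suc n = q * q ^ℚ n

logPartial : (N : ℕ) .{{_ : ℕ.NonZero N}} → ℕ → ℚ
logPartial N zero    = 0ℚ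
logPartial N (suc n) = logPartial N n + (1ℚ - + 1 / N) ^ℚ suc n * (+ 1 / suc n)

private

  ↑ : ℕ → ℚ
  ↑ n = + n / 1

  toℚᵘ-/ : ∀ i n .{{_ : ℕ.NonZero n}} → ℚ.toℚᵘ (i / n) ≃ᵘ i /ᵘ n
  toℚᵘ-/ i (suc n) = ℚ.toℚᵘ-fromℚᵘ (mkℚᵘ i n)

  /-mono : ∀ i j m n .{{_ : ℕ.NonZero m}} .{{_ : ℕ.NonZero n}} →
           i /ᵘ m ≤ᵘ j /ᵘ n → i / m ≤ j / n
  /-mono i j m n le = ℚ.toℚᵘ-cancel-≤
    (ℚᵘ.≤-respˡ-≃ (ℚᵘ.≃-sym (toℚᵘ-/ i m)) (ℚᵘ.≤-respʳ-≃ (ℚᵘ.≃-sym (toℚᵘ-/ j n)) le))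

  ↑-mono : ∀ {m n} → m ℕ.≤ n → ↑ m ≤ ↑ n
  ↑-mono {m} {n} m≤n = /-mono (+ m) (+ n) 1 1
    (*≤* (ℤ.*-monoʳ-≤-nonNeg (+ 1) (ℤ.+≤+ m≤n)))

  0≤↑ : ∀ n → 0ℚ ≤ ↑ n
  0≤↑ n = ↑-mono {0} {n} ℕ.z≤n

  0<↑ : ∀ n .{{_ : ℕ.NonZero n}} → 0ℚ < ↑ n
  0<↑ (suc n) = ℚ.<-≤-trans (ℚ.positive⁻¹ 1ℚ) (↑-mono {1} {suc n} (ℕ.s≤s ℕ.z≤n))

  ↑-suc : ∀ n → ↑ (suc n) ≡ 1ℚ + ↑ n
  ↑-suc n = ℚ.toℚᵘ-injective (ℚᵘ.≃-trans (toℚᵘ-/ (+ suc n) 1) (ℚᵘ.≃-sym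
    (ℚᵘ.≃-trans (ℚ.toℚᵘ-homo-+ 1ℚ (↑ n)) (ℚᵘ.≃-trans (ℚᵘ.+-congʳ (ℚ.toℚᵘ 1ℚ) (toℚᵘ-/ (+ n) 1))
      (*≡* (cong (ℤ._* + 1) (cong (λ z → + 1 ℤ.+ z) (ℤ.*-identityʳ (+ n)))))))))

  ↑-* : ∀ m n → ↑ (m ℕ.* n) ≡ ↑ m * ↑ n
  ↑-* m n = ℚ.toℚᵘ-injective (ℚᵘ.≃-trans (toℚᵘ-/ (+ (m ℕ.* n)) 1) (ℚᵘ.≃-sym
    (ℚᵘ.≃-trans (ℚ.toℚᵘ-homo-* (↑ m) (↑ n))
      (ℚᵘ.≃-trans (ℚᵘ.*-cong (toℚᵘ-/ (+ m) 1) (toℚᵘ-/ (+ n) 1))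
        (*≡* (cong (ℤ._* + 1) (sym (ℤ.pos-* m n))))))))

  0≤1/n : ∀ n .{{_ : ℕ.NonZero n}} → 0ℚ ≤ + 1 / n
  0≤1/n n@(suc _) = /-mono (+ 0) (+ 1) 1 n (*≤* (ℤ.+≤+ ℕ.z≤n))

  1/n≤1 : ∀ n .{{_ : ℕ.NonZero n}} → + 1 / n ≤ 1ℚ
  1/n≤1 n@(suc _) = /-mono (+ 1) (+ 1) n 1 (*≤* (ℤ.+≤+ (ℕ.s≤s ℕ.z≤n)))

  ↑n*1/n≡1 : ∀ n .{{_ : ℕ.NonZero n}} → ↑ n * (+ 1 / n) ≡ 1ℚ
  ↑n*1/n≡1 n@(suc k) = ℚ.toℚᵘ-injective (ℚᵘ.≃-trans (ℚ.toℚᵘ-homo-* (↑ n) (+ 1 / n))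
    (ℚᵘ.≃-trans (ℚᵘ.*-cong (toℚᵘ-/ (+ n) 1) (toℚᵘ-/ (+ 1) n))
      (*≡* (cong +_ (eq k)))))
    where
    eq : ∀ k → (suc k ℕ.* 1) ℕ.* 1 ≡ 1 ℕ.* (1 ℕ.* suc k)
    eq = solve-∀

  archimedean : ∀ ε .{{_ : ℚ.Positive ε}} K → ∃[ M ] ↑ K ≤ ε * ↑ M
  archimedean ε@(mkℚ (+ suc a) d _) K = M , ℚ.toℚᵘ-cancel-≤
    (ℚᵘ.≤-respˡ-≃ (ℚᵘ.≃-sym (toℚᵘ-/ (+ K) 1))
      (ℚᵘ.≤-respʳ-≃ (ℚᵘ.≃-sym (ℚᵘ.≃-trans (ℚ.toℚᵘ-homo-* ε (↑ M))
          (ℚᵘ.*-congˡ {ℚ.toℚᵘ ε} (toℚᵘ-/ (+ M) 1))))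
        (*≤* (subst₂ ℤ._≤_ (ℤ.pos-* K (suc d ℕ.* 1))
          (trans (ℤ.pos-* (suc a ℕ.* M) 1) (cong (ℤ._* + 1) (ℤ.pos-* (suc a) M)))
          (ℤ.+≤+ bound)))))
    where
    M = suc d ℕ.* K
    open ℕ.≤-Reasoning
    eq₁ : ∀ K d → K ℕ.* (suc d ℕ.* 1) ≡ suc d ℕ.* K
    eq₁ = solve-∀
    bound : K ℕ.* (suc d ℕ.* 1) ℕ.≤ (suc a ℕ.* M) ℕ.* 1
    bound = begin
      K ℕ.* (suc d ℕ.* 1)    ≡⟨ eq₁ K d ⟩
      M                      ≤⟨ ℕ.m≤m+n M (a ℕ.* M) ⟩
      suc a ℕ.* M            ≡⟨ ℕ.*-identityʳ (suc a ℕ.* M) ⟨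
      suc a ℕ.* M ℕ.* 1      ∎

  logPartial-cauchy : ∀ N .{{_ : ℕ.NonZero N}} → IsCauchy (logPartial N)
  logPartial-cauchy N ε 0<ε = M , close
    where
    open ℚ.≤-Reasoning
    open +-*-Solver

    u r : ℚ
    u = + 1 / N
    r = 1ℚ - u

    ν : ℚ
    ν = ↑ N

    νu≡1 : ν * u ≡ 1ℚ
    νu≡1 = ↑n*1/n≡1 N

    0≤r : 0ℚ ≤ r
    0≤r = begin
      0ℚ         ≡⟨ ℚ.+-inverseʳ 1ℚ ⟨
      1ℚ - 1ℚ    ≤⟨ ℚ.+-monoʳ-≤ 1ℚ (ℚ.neg-antimono-≤ (1/n≤1 N)) ⟩
      1ℚ - u     ∎

    instance
      ν-nonNeg : ℚ.NonNegative ν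
      ν-nonNeg = ℚ.nonNegative (0≤↑ N)
      u-nonNeg : ℚ.NonNegative u
      u-nonNeg = ℚ.nonNegative (0≤1/n N)
      r-nonNeg : ℚ.NonNegative r
      r-nonNeg = ℚ.nonNegative 0≤r
      ε-pos : ℚ.Positive ε
      ε-pos = ℚ.positive 0<ε
      ε-nonNeg : ℚ.NonNegative ε
      ε-nonNeg = ℚ.pos⇒nonNeg ε

    pow-nonNeg : ∀ n → ℚ.NonNegative (r ^ℚ n)
    pow-nonNeg zero    = _
    pow-nonNeg (suc n) = ℚ.nonNeg*nonNeg⇒nonNeg r (r ^ℚ n) {{pow-nonNeg n}}

    r≤1 : r ≤ 1ℚ
    r≤1 = begin
      1ℚ - u     ≤⟨ ℚ.+-monoʳ-≤ 1ℚ (ℚ.neg-antimono-≤ (0≤1/n N)) ⟩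
      1ℚ - 0ℚ    ≡⟨⟩
      1ℚ         ∎

    tail : ℕ → ℚ
    tail n = ν * r ^ℚ n

    bernoulli : ∀ n → r ^ℚ n * (ν + ↑ n) ≤ ν
    bernoulli zero = ℚ.≤-reflexive (trans (ℚ.*-identityˡ (ν + 0ℚ)) (ℚ.+-identityʳ ν))
    bernoulli (suc n) = begin
      r * r ^ℚ n * (ν + ↑ (suc n))
        ≡⟨ cong (λ z → r * r ^ℚ n * (ν + z)) (↑-suc n) ⟩
      (1ℚ - u) * r ^ℚ n * (ν + (1ℚ + ↑ n))
        ≡⟨ solve 4 (λ u ρ ν n → (con 1ℚ :- u) :* ρ :* (ν :+ (con 1ℚ :+ n))
                               := ρ :* (ν :+ n :+ (con 1ℚ :- ν :* u) :- u :* (con 1ℚ :+ n)))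
             refl u (r ^ℚ n) ν (↑ n) ⟩
      r ^ℚ n * (ν + ↑ n + (1ℚ - ν * u) - u * (1ℚ + ↑ n))
        ≡⟨ cong (λ z → r ^ℚ n * (ν + ↑ n + (1ℚ - z) - u * (1ℚ + ↑ n))) νu≡1 ⟩
      r ^ℚ n * (ν + ↑ n + 0ℚ - u * (1ℚ + ↑ n))
        ≤⟨ ℚ.*-monoˡ-≤-nonNeg (r ^ℚ n) {{pow-nonNeg n}}
             (ℚ.+-monoʳ-≤ (ν + ↑ n + 0ℚ) (ℚ.neg-antimono-≤ 0≤drop)) ⟩
      r ^ℚ n * (ν + ↑ n + 0ℚ - 0ℚ)
        ≡⟨ cong (r ^ℚ n *_) (solve 1 (λ a → a :+ con 0ℚ :- con 0ℚ := a) refl (ν + ↑ n)) ⟩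
      r ^ℚ n * (ν + ↑ n)
        ≤⟨ bernoulli n ⟩
      ν ∎
      where
      0≤drop : 0ℚ ≤ u * (1ℚ + ↑ n)
      0≤drop = ℚ.nonNegative⁻¹ _ {{ℚ.nonNeg*nonNeg⇒nonNeg u (1ℚ + ↑ n)
                 {{ℚ.nonNeg+nonNeg⇒nonNeg 1ℚ (↑ n) {{ℚ.nonNegative (0≤↑ n)}}}}}}

    M : ℕ
    M = proj₁ (archimedean ε (N ℕ.* N))

    tail-≤ : ∀ n → M ℕ.≤ n → tail n ≤ ε
    tail-≤ n M≤n = ℚ.≮⇒≥ λ ε<tail → ℚ.<-irrefl refl (begin-strict
      ε * (ν + ↑ n)               <⟨ ℚ.*-monoˡ-<-pos (ν + ↑ n) {{ν+n-pos}} ε<tail ⟩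
      ν * r ^ℚ n * (ν + ↑ n)      ≡⟨ ℚ.*-assoc ν (r ^ℚ n) (ν + ↑ n) ⟩
      ν * (r ^ℚ n * (ν + ↑ n))    ≤⟨ ℚ.*-monoˡ-≤-nonNeg ν (bernoulli n) ⟩
      ν * ν                       ≡⟨ ↑-* N N ⟨
      ↑ (N ℕ.* N)                 ≤⟨ proj₂ (archimedean ε (N ℕ.* N)) ⟩
      ε * ↑ M                     ≤⟨ ℚ.*-monoˡ-≤-nonNeg ε (↑-mono M≤n) ⟩
      ε * ↑ n                     ≡⟨ cong (ε *_) (ℚ.+-identityˡ (↑ n)) ⟨
      ε * (0ℚ + ↑ n)              ≤⟨ ℚ.*-monoˡ-≤-nonNeg ε (ℚ.+-monoˡ-≤ (↑ n) (0≤↑ N)) ⟩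
      ε * (ν + ↑ n)               ∎)
      where
      ν+n-pos : ℚ.Positive (ν + ↑ n)
      ν+n-pos = ℚ.pos+nonNeg⇒pos ν {{ℚ.positive (0<↑ N)}} (↑ n) {{ℚ.nonNegative (0≤↑ n)}}

    S : ℕ → ℚ
    S = logPartial N

    term : ℕ → ℚ
    term n = r ^ℚ suc n * (+ 1 / suc n)

    S-step : ∀ n → S n ≤ S (suc n)
    S-step n = begin
      S n             ≡⟨ ℚ.+-identityʳ (S n) ⟨
      S n + 0ℚ        ≤⟨ ℚ.+-monoʳ-≤ (S n) 0≤term ⟩
      S n + term n    ∎
      where
      0≤term : 0ℚ ≤ term n
      0≤term = ℚ.nonNegative⁻¹ _ {{ℚ.nonNeg*nonNeg⇒nonNeg (r ^ℚ suc n) {{pow-nonNeg (suc n)}}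
                 (+ 1 / suc n) {{ℚ.nonNegative (0≤1/n (suc n))}}}}

    upper-step : ∀ n → S (suc n) + tail (suc n) ≤ S n + tail n
    upper-step n = begin
      S n + term n + ν * (r * r ^ℚ n)
        ≤⟨ ℚ.+-monoˡ-≤ (tail (suc n)) (ℚ.+-monoʳ-≤ (S n) term≤) ⟩
      S n + r ^ℚ n + ν * ((1ℚ - u) * r ^ℚ n)
        ≡⟨ solve 4 (λ s ρ ν u → s :+ ρ :+ ν :* ((con 1ℚ :- u) :* ρ)
                               := s :+ ν :* ρ :+ (con 1ℚ :- ν :* u) :* ρ)
             refl (S n) (r ^ℚ n) ν u ⟩
      S n + ν * r ^ℚ n + (1ℚ - ν * u) * r ^ℚ n
        ≡⟨ cong (λ z → S n + ν * r ^ℚ n + (1ℚ - z) * r ^ℚ n) νu≡1 ⟩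
      S n + ν * r ^ℚ n + 0ℚ * r ^ℚ n
        ≡⟨ solve 2 (λ a b → a :+ con 0ℚ :* b := a) refl (S n + tail n) (r ^ℚ n) ⟩
      S n + ν * r ^ℚ n ∎
      where
      term≤ : term n ≤ r ^ℚ n
      term≤ = begin
        r * r ^ℚ n * (+ 1 / suc n)
          ≤⟨ ℚ.*-monoˡ-≤-nonNeg (r ^ℚ suc n) {{pow-nonNeg (suc n)}} (1/n≤1 (suc n)) ⟩
        r * r ^ℚ n * 1ℚ    ≡⟨ ℚ.*-identityʳ (r * r ^ℚ n) ⟩
        r * r ^ℚ n         ≤⟨ ℚ.*-monoʳ-≤-nonNeg (r ^ℚ n) {{pow-nonNeg n}} r≤1 ⟩
        1ℚ * r ^ℚ n        ≡⟨ ℚ.*-identityˡ (r ^ℚ n) ⟩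
        r ^ℚ n             ∎

    S-mono : ∀ {m n} → m ℕ.≤′ n → S m ≤ S n
    S-mono ℕ.≤′-refl           = ℚ.≤-refl
    S-mono (ℕ.≤′-step {n} m≤n) = ℚ.≤-trans (S-mono m≤n) (S-step n)

    upper-mono : ∀ {m n} → m ℕ.≤′ n → S n + tail n ≤ S m + tail m
    upper-mono ℕ.≤′-refl           = ℚ.≤-refl
    upper-mono (ℕ.≤′-step {n} m≤n) = ℚ.≤-trans (upper-step n) (upper-mono m≤n)

    gap : ∀ m n → M ℕ.≤ m → m ℕ.≤ n → ∣ S n - S m ∣ ≤ ε
    gap m n M≤m m≤n = begin
      ∣ S n - S m ∣               ≡⟨ ℚ.0≤p⇒∣p∣≡p 0≤Sn-Sm ⟩
      S n - S m                   ≡⟨ cong (_- S m) (ℚ.+-identityʳ (S n)) ⟨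
      S n + 0ℚ - S m              ≤⟨ ℚ.+-monoˡ-≤ (- S m) (ℚ.+-monoʳ-≤ (S n) 0≤tail) ⟩
      S n + tail n - S m          ≤⟨ ℚ.+-monoˡ-≤ (- S m) (upper-mono (ℕ.≤⇒≤′ m≤n)) ⟩
      S m + tail m - S m          ≡⟨ solve 2 (λ a b → a :+ b :- a := b) refl (S m) (tail m) ⟩
      tail m                      ≤⟨ tail-≤ m M≤m ⟩
      ε                           ∎
      where
      0≤Sn-Sm : 0ℚ ≤ S n - S m
      0≤Sn-Sm = begin
        0ℚ           ≡⟨ ℚ.+-inverseʳ (S m) ⟨
        S m - S m    ≤⟨ ℚ.+-monoˡ-≤ (- S m) (S-mono (ℕ.≤⇒≤′ m≤n)) ⟩
        S n - S m    ∎
      0≤tail : 0ℚ ≤ tail n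
      0≤tail = ℚ.nonNegative⁻¹ _ {{ℚ.nonNeg*nonNeg⇒nonNeg ν (r ^ℚ n) {{pow-nonNeg n}}}}

    close : ∀ m n → M ℕ.≤ m → M ℕ.≤ n → ∣ S m - S n ∣ ≤ ε
    close m n M≤m M≤n with ℕ.≤-total m n
    ... | inj₂ n≤m = gap n m M≤n n≤m
    ... | inj₁ m≤n = subst (_≤ ε)
      (trans (sym (ℚ.∣-p∣≡∣p∣ (S n - S m)))
             (cong ∣_∣ (solve 2 (λ a b → :- (a :- b) := b :- a) refl (S n) (S m))))
      (gap m n M≤m m≤n)

log : (N : ℕ) .{{_ : ℕ.NonZero N}} → ℝ
log N = mkℝ (logPartial N) (logPartial-cauchy N)

-- Write 1/x₁ + … + 1/x_k = u/v with v = x₁ ⋯ x_k ≤ V = N^k.  Then u ≤ U = k N^(k-1)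
-- and u/v ≥ U/V.  Modulo p the sum of the inverses determines u/v, so two tuples with
-- congruent sums give lattice points whose determinant is a multiple of p; unless it
-- vanishes, their slopes v/u ≤ V/U differ by at least p/U².  A residue class therefore
-- carries at most UV/p + 1 distinct rational values, and by Cauchy–Schwarz J₂ₖ is at
-- most (UV/p + 1) times the number of solutions of the equation over ℚ.
--
-- If the sums agree over ℚ, a prime dividing P = x₁ ⋯ x₂ₖ divides it at least twice.
-- Splitting off primes in twos and threes, every x_i becomes a product of parameters, each
-- of which occurs twice (4k² parameters) or three times (8k³ parameters) in P ≤ N^(2k).
-- Counting the parameters dyadically, each of the former costs a logarithm and each of the
-- latter only a constant because ∑ n^(-3/2) converges; the product of all parameters to the
-- power 1 or 3/2 is at most N^k.

module Submission where

open import Defs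
open import Data.Bool.Base using (if_then_else_; true; false)
open import Data.Fin.Base using (Fin; zero; suc)
open import Data.Integer.Base as ℤ using (+_)
import Data.Integer.Properties as ℤ
open import Data.List.Base as List using (List; []; _∷_; [_]; upTo; applyUpTo; filter; length; map; cartesianProductWith; concatMap; allFin)
open import Data.List.Membership.Propositional using (_∈_)
open import Data.List.Membership.Propositional.Properties
open import Data.List.Properties using (length-++; length-upTo; length-map; length-applyUpTo; length-tabulate; map-++)
import Data.List.Relation.Unary.All as ListAll
open import Data.List.Relation.Unary.AllPairs using ([]; _∷_)
open import Data.List.Relation.Unary.Any as Any using (here; there)
open import Data.List.Relation.Unary.Unique.Propositional using (Unique)
open import Data.List.Relation.Unary.Unique.Propositional.Properties using (upTo⁺; map⁺; filter⁺; cartesianProductWith⁺)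
open import Data.Nat.Base as ℕ renaming (_/_ to _/ℕ_)
open import Data.Nat.Coprimality as Coprime using (Coprime; prime⇒coprime)
open import Data.Nat.Divisibility
open import Data.Nat.DivMod hiding (_/_)
open import Data.Nat.Induction using (<-wellFounded)
open import Data.Nat.ListAction using (product)
open import Data.Nat.ListAction.Properties using (product-++)
open import Data.Nat.Primality using (Prime; euclidsLemma; prime⇒irreducible; prime⇒nonZero; prime⇒nonTrivial; ¬prime[1])
open import Data.Nat.Primality.Factorisation using (factorise)
open import Data.Nat.Properties
open import Data.Nat.Tactic.RingSolver using (solve-∀)
open import Data.Product.Base using (_×_; _,_; proj₁; proj₂; ∃-syntax)
open import Data.Rational.Base as ℚ using (ℚ; 0ℚ; 1ℚ; ½; _/_) renaming (_+_ to _+ℚ_)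
import Data.Rational.Properties as ℚ
open import Data.Rational.Solver using (module +-*-Solver)
open import Data.Rational.Unnormalised.Base as ℚᵘ using (mkℚᵘ; *≡*; *≤*)
import Data.Rational.Unnormalised.Properties as ℚᵘ
open import Data.Sum.Base using (inj₁; inj₂)
open import Data.Vec.Base as Vec using (Vec; []; _∷_; _++_; zipWith; replicate)
open import Data.Vec.Properties using (∷-injective; take++drop≡id; zipWith-assoc; zipWith-comm; zipWith-identityˡ)
open import Data.Vec.Relation.Unary.All as All using (All; []; _∷_)
open import Function.Base using (_∘_; it)
open import Induction.WellFounded using (Acc; acc)
open import Relation.Binary.Definitions using (tri<; tri≈; tri>)
open import Relation.Binary.PropositionalEquality hiding ([_])
open import Relation.Nullary.Decidable using (Dec; does; yes; no; dec-true; _×-dec_)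
open import Relation.Nullary.Negation using (¬_; contradiction)
open import Relation.Unary using (Pred; Decidable)

private
  variable
    A B : Set
    n : ℕ

-- Sums over lists and collision counts

∑ : List A → (A → ℕ) → ℕ
∑ []       f = 0
∑ (x ∷ xs) f = f x + ∑ xs f

⟦_⟧ : {P : Set} → Dec P → ℕ
⟦ d ⟧ = if does d then 1 else 0

⟦⟧-true : ∀ {P : Set} (d : Dec P) → P → ⟦ d ⟧ ≡ 1
⟦⟧-true d p rewrite dec-true d p = refl

⟦⟧-mono : ∀ {P Q : Set} (d : Dec P) (e : Dec Q) → (P → Q) → ⟦ d ⟧ ≤ ⟦ e ⟧
⟦⟧-mono (no _)  e P⇒Q = z≤n
⟦⟧-mono (yes p) e P⇒Q = ≤-reflexive (sym (⟦⟧-true e (P⇒Q p)))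

⟦⟧-× : ∀ {P Q : Set} (d : Dec P) (e : Dec Q) → ⟦ d ×-dec e ⟧ ≡ ⟦ d ⟧ * ⟦ e ⟧
⟦⟧-× (no _)  e       = refl
⟦⟧-× (yes _) (no _)  = refl
⟦⟧-× (yes _) (yes _) = refl

∑-cong : ∀ (xs : List A) {f g} → (∀ x → f x ≡ g x) → ∑ xs f ≡ ∑ xs g
∑-cong []       f≗g = refl
∑-cong (x ∷ xs) f≗g = cong₂ _+_ (f≗g x) (∑-cong xs f≗g)

∑-mono : ∀ (xs : List A) {f g} → (∀ {x} → x ∈ xs → f x ≤ g x) → ∑ xs f ≤ ∑ xs g
∑-mono []       f≤g = z≤n
∑-mono (x ∷ xs) f≤g = +-mono-≤ (f≤g (here refl)) (∑-mono xs (f≤g ∘ there))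

∑-const : ∀ (xs : List A) c → ∑ xs (λ _ → c) ≡ length xs * c
∑-const []       c = refl
∑-const (x ∷ xs) c = cong (c ℕ.+_) (∑-const xs c)

∑-distrib-+ : ∀ (xs : List A) f g → ∑ xs (λ x → f x + g x) ≡ ∑ xs f + ∑ xs g
∑-distrib-+ []       f g = refl
∑-distrib-+ (x ∷ xs) f g = trans (cong (f x + g x ℕ.+_) (∑-distrib-+ xs f g)) (eq (f x) (g x) _ _)
  where
  eq : ∀ a b c d → a + b + (c + d) ≡ a + c + (b + d)
  eq = solve-∀

∑-distribˡ-* : ∀ (xs : List A) c f → c * ∑ xs f ≡ ∑ xs (λ x → c * f x)
∑-distribˡ-* []       c f = *-zeroʳ c
∑-distribˡ-* (x ∷ xs) c f = trans (*-distribˡ-+ c (f x) _) (cong (c * f x ℕ.+_) (∑-distribˡ-* xs c f))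

∑-distribʳ-* : ∀ (xs : List A) c f → ∑ xs f * c ≡ ∑ xs (λ x → f x * c)
∑-distribʳ-* xs c f = trans (*-comm (∑ xs f) c)
  (trans (∑-distribˡ-* xs c f) (∑-cong xs λ x → *-comm c (f x)))

∑-swap : ∀ (xs : List A) (ys : List B) (f : A → B → ℕ) →
         ∑ xs (λ x → ∑ ys (λ y → f x y)) ≡ ∑ ys (λ y → ∑ xs (λ x → f x y))
∑-swap []       ys f = sym (trans (∑-const ys 0) (*-zeroʳ (length ys)))
∑-swap (x ∷ xs) ys f = trans (cong (∑ ys (f x) ℕ.+_) (∑-swap xs ys f)) (sym (∑-distrib-+ ys (f x) (λ y → ∑ xs (λ x → f x y))))

∑-swap₂ : ∀ {C : Set} (xs : List A) (ys : List B) (zs : List C) (f : A → B → C → ℕ) →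
          ∑ xs (λ x → ∑ ys (λ y → ∑ zs (λ z → f x y z))) ≡
          ∑ ys (λ y → ∑ zs (λ z → ∑ xs (λ x → f x y z)))
∑-swap₂ xs ys zs f = trans (∑-swap xs ys (λ x y → ∑ zs (f x y))) (∑-cong ys λ y → ∑-swap xs zs (λ x → f x y))

∑-product : ∀ (xs : List A) (ys : List B) f g →
            ∑ xs f * ∑ ys g ≡ ∑ xs (λ x → ∑ ys (λ y → f x * g y))
∑-product xs ys f g = trans (∑-distribʳ-* xs (∑ ys g) f) (∑-cong xs λ x → ∑-distribˡ-* ys (f x) g)

∑-++ : ∀ (xs ys : List A) f → ∑ (xs List.++ ys) f ≡ ∑ xs f + ∑ ys f
∑-++ []       ys f = refl
∑-++ (x ∷ xs) ys f = trans (cong (f x ℕ.+_) (∑-++ xs ys f)) (sym (+-assoc (f x) _ _))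

∑-map : ∀ (g : A → B) xs f → ∑ (map g xs) f ≡ ∑ xs (f ∘ g)
∑-map g []       f = refl
∑-map g (x ∷ xs) f = cong (f (g x) ℕ.+_) (∑-map g xs f)

length-filter≡∑ : ∀ {P : Pred A _} (P? : Decidable P) xs → length (filter P? xs) ≡ ∑ xs (λ x → ⟦ P? x ⟧)
length-filter≡∑ P? []       = refl
length-filter≡∑ P? (x ∷ xs) with does (P? x)
... | true  = cong suc (length-filter≡∑ P? xs)
... | false = length-filter≡∑ P? xs

∑-cartesianProductWith : ∀ {C : Set} (h : A → B → C) xs ys f →
  ∑ (cartesianProductWith h xs ys) f ≡ ∑ xs (λ x → ∑ ys (λ y → f (h x y)))
∑-cartesianProductWith h []       ys f = refl
∑-cartesianProductWith h (x ∷ xs) ys f = trans (∑-++ (map (h x) ys) _ f)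
  (cong₂ _+_ (∑-map (h x) ys f) (∑-cartesianProductWith h xs ys f))

∑-tuples-+ : ∀ (xs : List A) m n f →
  ∑ (tuples xs (m + n)) f ≡ ∑ (tuples xs m) (λ x → ∑ (tuples xs n) (λ y → f (x ++ y)))
∑-tuples-+ xs zero    n f = sym (+-identityʳ _)
∑-tuples-+ xs (suc m) n f = begin
  ∑ (tuples xs (suc m + n)) f
    ≡⟨ ∑-cartesianProductWith _∷_ xs (tuples xs (m + n)) f ⟩
  ∑ xs (λ a → ∑ (tuples xs (m + n)) (λ z → f (a ∷ z)))
    ≡⟨ ∑-cong xs (λ a → ∑-tuples-+ xs m n (λ z → f (a ∷ z))) ⟩
  ∑ xs (λ a → ∑ (tuples xs m) (λ x → ∑ (tuples xs n) (λ y → f (a ∷ x ++ y))))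
    ≡⟨ ∑-cartesianProductWith _∷_ xs (tuples xs m) _ ⟨
  ∑ (tuples xs (suc m)) (λ x → ∑ (tuples xs n) (λ y → f (x ++ y))) ∎
  where open ≡-Reasoning

∑-applyUpTo : ∀ (h : ℕ → A) n f → ∑ (applyUpTo h n) f ≡ ∑ (upTo n) (f ∘ h)
∑-applyUpTo {A} h n f = go (λ i → i) n
  where
  go : ∀ (s : ℕ → ℕ) n → ∑ (applyUpTo (h ∘ s) n) f ≡ ∑ (applyUpTo s n) (f ∘ h)
  go s zero    = refl
  go s (suc n) = cong (f (h (s 0)) ℕ.+_) (go (s ∘ suc) n)

∑-upTo-suc : ∀ n f → ∑ (upTo (suc n)) f ≡ f 0 + ∑ (upTo n) (f ∘ suc)
∑-upTo-suc n f = cong (f 0 ℕ.+_) (∑-applyUpTo suc n f)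

∑-select : ∀ n (f : ℕ → ℕ) {a} → a < n → ∑ (upTo n) (λ c → ⟦ a ≟ c ⟧ * f c) ≡ f a
∑-select (suc n) f {zero} _ = begin
  ∑ (upTo (suc n)) (λ c → ⟦ 0 ≟ c ⟧ * f c)
    ≡⟨ ∑-upTo-suc n _ ⟩
  1 * f 0 + ∑ (upTo n) (λ c → ⟦ 0 ≟ suc c ⟧ * f (suc c))
    ≡⟨ cong₂ _+_ (*-identityˡ (f 0)) (trans (∑-const (upTo n) 0) (*-zeroʳ (length (upTo n)))) ⟩
  f 0 + 0  ≡⟨ +-identityʳ (f 0) ⟩
  f 0      ∎
  where open ≡-Reasoning
∑-select (suc n) f {suc a} (s≤s a<n) = begin
  ∑ (upTo (suc n)) (λ c → ⟦ suc a ≟ c ⟧ * f c)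
    ≡⟨ ∑-upTo-suc n (λ c → ⟦ suc a ≟ c ⟧ * f c) ⟩
  ∑ (upTo n) (λ c → ⟦ a ≟ c ⟧ * f (suc c))
    ≡⟨ ∑-select n (f ∘ suc) a<n ⟩
  f (suc a) ∎
  where open ≡-Reasoning

-- Summing over the common value `c` turns a count of coinciding pairs into a sum of squared fibre
-- sizes, the form to which Cauchy-Schwarz applies.
∑-⟦≟⟧ : ∀ n {a b} → a < n → ∑ (upTo n) (λ c → ⟦ a ≟ c ⟧ * ⟦ b ≟ c ⟧) ≡ ⟦ a ≟ b ⟧
∑-⟦≟⟧ n {a} {b} a<n = trans (∑-select n (λ c → ⟦ b ≟ c ⟧) a<n)
  (≤-antisym (⟦⟧-mono (b ≟ a) (a ≟ b) sym) (⟦⟧-mono (a ≟ b) (b ≟ a) sym))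

-- Writing the larger number as the smaller plus `d`, the two sides differ by `d * d`.
2mn≤m²+n² : ∀ m n → 2 * (m * n) ≤ m * m + n * n
2mn≤m²+n² m n with ≤-total m n
... | inj₁ m≤n with d , refl ← m≤n⇒∃[o]m+o≡n m≤n = ≤-trans (m≤m+n _ (d * d)) (≤-reflexive (eq m d))
  where
  eq : ∀ m d → 2 * (m * (m + d)) + d * d ≡ m * m + (m + d) * (m + d)
  eq = solve-∀
... | inj₂ n≤m with d , refl ← m≤n⇒∃[o]m+o≡n n≤m = ≤-trans (m≤m+n _ (d * d)) (≤-reflexive (eq n d))
  where
  eq : ∀ n d → 2 * ((n + d) * n) + d * d ≡ (n + d) * (n + d) + n * n
  eq = solve-∀

-- Induction on the list; the cross term `2 * (a * s)` is bounded summand by summand with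
-- `2mn≤m²+n²`.
∑-cauchySchwarz : ∀ (xs : List A) f → ∑ xs f * ∑ xs f ≤ length xs * ∑ xs (λ x → f x * f x)
∑-cauchySchwarz []       f = z≤n
∑-cauchySchwarz (x ∷ xs) f = begin
  (a + s) * (a + s)                      ≡⟨ eq₁ a s ⟩
  a * a + 2 * (a * s) + s * s            ≤⟨ +-mono-≤ (+-monoʳ-≤ (a * a) cross) (∑-cauchySchwarz xs f) ⟩
  a * a + (l * (a * a) + q) + l * q      ≡⟨ eq₂ (a * a) l q ⟩
  (1 + l) * (a * a + q)                  ∎
  where
  open ≤-Reasoning
  a = f x
  s = ∑ xs f
  l = length xs
  q = ∑ xs (λ y → f y * f y)
  cross : 2 * (a * s) ≤ l * (a * a) + q
  cross = begin
    2 * (a * s)                               ≡⟨ cong (2 *_) (∑-distribˡ-* xs a f) ⟩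
    2 * ∑ xs (λ y → a * f y)                  ≡⟨ ∑-distribˡ-* xs 2 _ ⟩
    ∑ xs (λ y → 2 * (a * f y))                ≤⟨ ∑-mono xs (λ {y} _ → 2mn≤m²+n² a (f y)) ⟩
    ∑ xs (λ y → a * a + f y * f y)            ≡⟨ ∑-distrib-+ xs _ _ ⟩
    ∑ xs (λ _ → a * a) + q                    ≡⟨ cong (_+ q) (∑-const xs (a * a)) ⟩
    l * (a * a) + q                           ∎
  eq₁ : ∀ a s → (a + s) * (a + s) ≡ a * a + 2 * (a * s) + s * s
  eq₁ = solve-∀
  eq₂ : ∀ a l q → a + (l * a + q) + l * q ≡ (1 + l) * (a + q)
  eq₂ = solve-∀

-- Cauchy–Schwarz on each fibre of f, which key splits into at most R parts.
collisions-refine : ∀ (xs : List A) (f key : A → ℕ) p R → (∀ x → f x < p) → (∀ {x} → x ∈ xs → key x < R) →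
  ∑ xs (λ x → ∑ xs (λ y → ⟦ f x ≟ f y ⟧)) ≤
  R * ∑ xs (λ x → ∑ xs (λ y → ⟦ (f x ≟ f y) ×-dec (key x ≟ key y) ⟧))
collisions-refine xs f key p R f<p key<R = begin
  ∑ xs (λ x → ∑ xs (λ y → ⟦ f x ≟ f y ⟧))
    ≡⟨ ∑-cong xs (λ x → ∑-cong xs λ y → ∑-⟦≟⟧ p (f<p x)) ⟨
  ∑ xs (λ x → ∑ xs (λ y → ∑ (upTo p) λ c → ⟦ f x ≟ c ⟧ * ⟦ f y ≟ c ⟧))
    ≡⟨ squares p (λ c x → ⟦ f x ≟ c ⟧) ⟨
  ∑ (upTo p) (λ c → ∑ xs (λ x → ⟦ f x ≟ c ⟧) * ∑ xs (λ x → ⟦ f x ≟ c ⟧))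
    ≤⟨ ∑-mono (upTo p) (λ {c} _ → *-mono-≤ (split c) (split c)) ⟩
  ∑ (upTo p) (λ c → ∑ (upTo R) (m c) * ∑ (upTo R) (m c))
    ≤⟨ ∑-mono (upTo p) (λ {c} _ → ∑-cauchySchwarz (upTo R) (m c)) ⟩
  ∑ (upTo p) (λ c → length (upTo R) * ∑ (upTo R) (λ κ → m c κ * m c κ))
    ≡⟨ ∑-cong (upTo p) (λ c → cong (_* ∑ (upTo R) (λ κ → m c κ * m c κ)) (length-upTo R)) ⟩
  ∑ (upTo p) (λ c → R * ∑ (upTo R) (λ κ → m c κ * m c κ))
    ≡⟨ ∑-distribˡ-* (upTo p) R _ ⟨
  R * ∑ (upTo p) (λ c → ∑ (upTo R) (λ κ → m c κ * m c κ))
    ≡⟨ cong (R *_) (∑-cong (upTo p) λ c → squares R (λ κ x → ⟦ f x ≟ c ⟧ * ⟦ key x ≟ κ ⟧)) ⟩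
  R * ∑ (upTo p) (λ c → ∑ xs (λ x → ∑ xs (λ y → ∑ (upTo R) (λ κ → e c κ x * e c κ y))))
    ≡⟨ cong (R *_) (∑-swap₂ (upTo p) xs xs (λ c x y → ∑ (upTo R) (λ κ → e c κ x * e c κ y))) ⟩
  R * ∑ xs (λ x → ∑ xs (λ y → ∑ (upTo p) (λ c → ∑ (upTo R) (λ κ → e c κ x * e c κ y))))
    ≤⟨ *-monoʳ-≤ R (∑-mono xs λ {x} x∈ → ∑-mono xs λ {y} _ → ≤-reflexive (pair x y (key<R x∈))) ⟩
  R * ∑ xs (λ x → ∑ xs (λ y → ⟦ (f x ≟ f y) ×-dec (key x ≟ key y) ⟧)) ∎
  where
  open ≤-Reasoning

  e : ℕ → ℕ → _ → ℕ
  e c κ x = ⟦ f x ≟ c ⟧ * ⟦ key x ≟ κ ⟧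

  m : ℕ → ℕ → ℕ
  m c κ = ∑ xs (e c κ)

  squares : ∀ k (h : ℕ → _ → ℕ) → ∑ (upTo k) (λ c → ∑ xs (h c) * ∑ xs (h c)) ≡
            ∑ xs (λ x → ∑ xs (λ y → ∑ (upTo k) (λ c → h c x * h c y)))
  squares k h = trans (∑-cong (upTo k) λ c → ∑-product xs xs (h c) (h c))
    (∑-swap₂ (upTo k) xs xs (λ c x y → h c x * h c y))

  split : ∀ c → ∑ xs (λ x → ⟦ f x ≟ c ⟧) ≤ ∑ (upTo R) (m c)
  split c = begin
    ∑ xs (λ x → ⟦ f x ≟ c ⟧)
      ≤⟨ ∑-mono xs (λ {x} x∈ → ≤-reflexive (sym (trans (∑-cong (upTo R) λ κ → *-comm ⟦ f x ≟ c ⟧ ⟦ key x ≟ κ ⟧)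
           (∑-select R (λ _ → ⟦ f x ≟ c ⟧) (key<R x∈))))) ⟩
    ∑ xs (λ x → ∑ (upTo R) (λ κ → e c κ x))
      ≡⟨ ∑-swap xs (upTo R) (λ x κ → e c κ x) ⟩
    ∑ (upTo R) (m c) ∎

  interchange : ∀ a b c d → (a * b) * (c * d) ≡ (a * c) * (b * d)
  interchange = solve-∀

  -- After regrouping, the double sum factors into one sum over `c` and one over `κ`, and each
  -- collapses to an equality indicator.
  pair : ∀ x y → key x < R → ∑ (upTo p) (λ c → ∑ (upTo R) (λ κ → e c κ x * e c κ y)) ≡
         ⟦ (f x ≟ f y) ×-dec (key x ≟ key y) ⟧
  pair x y key<R = trans (∑-cong (upTo p) λ c → ∑-cong (upTo R) λ κ →
      interchange ⟦ f x ≟ c ⟧ ⟦ key x ≟ κ ⟧ ⟦ f y ≟ c ⟧ ⟦ key y ≟ κ ⟧)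
    (trans (sym (∑-product (upTo p) (upTo R) (λ c → ⟦ f x ≟ c ⟧ * ⟦ f y ≟ c ⟧) (λ κ → ⟦ key x ≟ κ ⟧ * ⟦ key y ≟ κ ⟧)))
    (trans (cong₂ _*_ (∑-⟦≟⟧ p (f<p x)) (∑-⟦≟⟧ R key<R)) (sym (⟦⟧-× (f x ≟ f y) (key x ≟ key y)))))

-- From the congruence to an equation over ℚ

-- Delete from `ys` one occurrence of the head `x`. As `x` does not recur in the tail, the tail is
-- still contained in what is left.
Unique-⊆⇒length≤ : ∀ {A : Set} {xs ys : List A} → Unique xs → (∀ {x} → x ∈ xs → x ∈ ys) → length xs ≤ length ys
Unique-⊆⇒length≤ []             xs⊆ys = z≤n
Unique-⊆⇒length≤ {A} {x ∷ xs} (x∉xs ∷ xs!) xs⊆ys with us , vs , refl ← ∈-∃++ (xs⊆ys (here refl)) = begin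
  suc (length xs)                 ≤⟨ s≤s (Unique-⊆⇒length≤ xs! xs⊆) ⟩
  suc (length (us List.++ vs))    ≡⟨ cong suc (length-++ us) ⟩
  suc (length us + length vs)     ≡⟨ +-suc (length us) (length vs) ⟨
  length us + suc (length vs)     ≡⟨ length-++ us ⟨
  length (us List.++ x ∷ vs)      ∎
  where
  open ≤-Reasoning
  xs⊆ : ∀ {y} → y ∈ xs → y ∈ us List.++ vs
  xs⊆ y∈xs with ∈-++⁻ us (xs⊆ys (there y∈xs))
  ... | inj₁ y∈us         = ∈-++⁺ˡ y∈us
  ... | inj₂ (here refl)  = contradiction refl (ListAll.lookup x∉xs y∈xs)
  ... | inj₂ (there y∈vs) = ∈-++⁺ʳ us y∈vs

∈-tuples⁻ : ∀ {A : Set} (xs : List A) n {z} → z ∈ tuples xs n → All (_∈ xs) z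
∈-tuples⁻ xs zero    (here refl) = []
∈-tuples⁻ xs (suc n) z∈ with a , y , a∈ , y∈ , refl ← ∈-cartesianProductWith⁻ _∷_ xs (tuples xs n) z∈ = a∈ ∷ ∈-tuples⁻ xs n y∈

tuples-unique : ∀ {A : Set} {xs : List A} n → Unique xs → Unique (tuples xs n)
tuples-unique zero    xs! = ListAll.[] ∷ []
tuples-unique (suc n) xs! = cartesianProductWith⁺ _∷_ ∷-injective xs! (tuples-unique n xs!)

interval-unique : ∀ N → Unique (interval N)
interval-unique N = map⁺ suc-injective (upTo⁺ N)

∈-interval⁻ : ∀ {N x} → x ∈ interval N → NonZero x × x ≤ N
∈-interval⁻ x∈ with i , i∈ , refl ← ∈-map⁻ suc x∈ = _ , ∈-upTo⁻ i∈

take-++ : ∀ {A : Set} m {n} (xs : Vec A m) (ys : Vec A n) → Vec.take m (xs ++ ys) ≡ xs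
take-++ zero    []       ys = refl
take-++ (suc m) (x ∷ xs) ys = cong (x ∷_) (take-++ m xs ys)
drop-++ : ∀ {A : Set} m {n} (xs : Vec A m) (ys : Vec A n) → Vec.drop m (xs ++ ys) ≡ ys
drop-++ zero    []       ys = refl
drop-++ (suc m) (x ∷ xs) ys = drop-++ m xs ys

-- Numerators and denominators of sums of reciprocals

∏ : Vec ℕ n → ℕ
∏ []       = 1
∏ (x ∷ xs) = x * ∏ xs

-- The numerator of 1/x₁ + … + 1/xₙ over the denominator x₁ ⋯ xₙ.
num : Vec ℕ n → ℕ
num []       = 0
num (x ∷ xs) = ∏ xs + x * num xs

∏-++ : ∀ {m} (xs : Vec ℕ m) (ys : Vec ℕ n) → ∏ (xs ++ ys) ≡ ∏ xs * ∏ ys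
∏-++ []       ys = sym (+-identityʳ (∏ ys))
∏-++ (x ∷ xs) ys = trans (cong (x *_) (∏-++ xs ys)) (sym (*-assoc x (∏ xs) (∏ ys)))

∏≢0 : ∀ {xs : Vec ℕ n} → All NonZero xs → NonZero (∏ xs)
∏≢0 []                    = _
∏≢0 {xs = x ∷ xs} (x≢0 ∷ xs≢0) = m*n≢0 x (∏ xs) {{x≢0}} {{∏≢0 xs≢0}}

num≢0 : ∀ {xs : Vec ℕ (suc n)} → All NonZero xs → NonZero (num xs)
num≢0 {xs = x ∷ xs} (_ ∷ xs≢0) = >-nonZero (≤-trans (>-nonZero⁻¹ (∏ xs) {{∏≢0 xs≢0}}) (m≤m+n _ _))

∏≤^ : ∀ {N} {xs : Vec ℕ n} → All (_≤ N) xs → ∏ xs ≤ N ^ n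
∏≤^ []            = ≤-refl
∏≤^ (x≤N ∷ xs≤N) = *-mono-≤ x≤N (∏≤^ xs≤N)

-- Each of the `n` summands of `num xs` omits one entry, so `N` times it is at least `∏ xs`. This
-- gives u/v ≥ U/V.
n*∏≤num*N : ∀ {N} {xs : Vec ℕ n} → All (_≤ N) xs → n * ∏ xs ≤ num xs * N
n*∏≤num*N []                             = z≤n
n*∏≤num*N {suc n} {N} {x ∷ xs} (x≤N ∷ xs≤N) = begin
  x * ∏ xs + n * (x * ∏ xs)         ≡⟨ eq₁ x (∏ xs) n ⟩
  x * ∏ xs + x * (n * ∏ xs)         ≤⟨ +-mono-≤ (*-monoˡ-≤ (∏ xs) x≤N) (*-monoʳ-≤ x (n*∏≤num*N xs≤N)) ⟩
  N * ∏ xs + x * (num xs * N)       ≡⟨ eq₂ N (∏ xs) x (num xs) ⟩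
  (∏ xs + x * num xs) * N           ∎
  where
  open ≤-Reasoning
  eq₁ : ∀ x a n → x * a + n * (x * a) ≡ x * a + x * (n * a)
  eq₁ = solve-∀
  eq₂ : ∀ N a x b → N * a + x * (b * N) ≡ (a + x * b) * N
  eq₂ = solve-∀

-- Each of the `n` summands is a product of n - 1 entries. The factor `N` on the left avoids the
-- exponent n - 1.
num*N≤n*N^n : ∀ {N} {xs : Vec ℕ n} → All (_≤ N) xs → num xs * N ≤ n * N ^ n
num*N≤n*N^n []                               = z≤n
num*N≤n*N^n {suc n} {N} {x ∷ xs} (x≤N ∷ xs≤N) = begin
  (∏ xs + x * num xs) * N           ≡⟨ eq₁ (∏ xs) x (num xs) N ⟩
  N * ∏ xs + x * (num xs * N)       ≤⟨ +-mono-≤ (*-monoʳ-≤ N (∏≤^ xs≤N)) (*-mono-≤ x≤N (num*N≤n*N^n xs≤N)) ⟩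
  N * N ^ n + N * (n * N ^ n)       ≡⟨ eq₂ N n (N ^ n) ⟩
  suc n * N ^ suc n                 ∎
  where
  open ≤-Reasoning
  eq₁ : ∀ a x b N → (a + x * b) * N ≡ N * a + x * (b * N)
  eq₁ = solve-∀
  eq₂ : ∀ N n a → N * a + N * (n * a) ≡ suc n * (N * a)
  eq₂ = solve-∀

-- Congruences modulo p

module _ (p : ℕ) .{{_ : NonZero p}} where

  +-cong-mod : ∀ {a b c d} → a ≡ b [mod p ] → c ≡ d [mod p ] → a + c ≡ b + d [mod p ]
  +-cong-mod {a} {b} {c} {d} a≡b c≡d = trans (%-distribˡ-+ a c p)
    (trans (cong₂ (λ x y → (x + y) % p) a≡b c≡d) (sym (%-distribˡ-+ b d p)))

  *-cong-mod : ∀ {a b c d} → a ≡ b [mod p ] → c ≡ d [mod p ] → a * c ≡ b * d [mod p ]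
  *-cong-mod {a} {b} {c} {d} a≡b c≡d = trans (%-distribˡ-* a c p)
    (trans (cong₂ (λ x y → (x * y) % p) a≡b c≡d) (sym (%-distribˡ-* b d p)))

  -- With equal remainders, `a < b` forces the quotient of `b` to be strictly larger. Applied to
  -- determinants, it says that a nonzero multiple of `p` is at least `p`.
  <∧≡-mod⇒+≤ : ∀ {a b} → a < b → a ≡ b [mod p ] → a + p ≤ b
  <∧≡-mod⇒+≤ {a} {b} a<b a≡b = begin
    a + p                         ≡⟨ cong (_+ p) (m≡m%n+[m/n]*n a p) ⟩
    a % p + a /ℕ p * p + p         ≡⟨ eq (a % p) (a /ℕ p) p ⟩
    a % p + suc (a /ℕ p) * p       ≤⟨ +-mono-≤ (≤-reflexive a≡b) (*-monoˡ-≤ p (≰⇒> b/p≰a/p)) ⟩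
    b % p + b /ℕ p * p             ≡⟨ m≡m%n+[m/n]*n b p ⟨
    b                             ∎
    where
    open ≤-Reasoning
    eq : ∀ r q p → r + q * p + p ≡ r + suc q * p
    eq = solve-∀
    b/p≰a/p : ¬ (b /ℕ p ≤ a /ℕ p)
    b/p≰a/p b/p≤a/p = <⇒≱ a<b (begin
      b                     ≡⟨ m≡m%n+[m/n]*n b p ⟩
      b % p + b /ℕ p * p     ≤⟨ +-mono-≤ (≤-reflexive (sym a≡b)) (*-monoˡ-≤ p b/p≤a/p) ⟩
      a % p + a /ℕ p * p     ≡⟨ m≡m%n+[m/n]*n a p ⟨
      a                     ∎)

  -- Clearing denominators modulo `p`: at each entry `x` the summand `∏ xs` receives the factor
  -- `x * inverse p x`, which is congruent to 1.
  num≡sumInverses*∏ : ∀ {xs : Vec ℕ n} → All (λ x → Coprime x p) xs → num xs ≡ sumInverses p xs * ∏ xs [mod p ]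
  num≡sumInverses*∏ []                       = refl
  num≡sumInverses*∏ {xs = x ∷ xs} (c ∷ cs) = begin
    (∏ xs + x * num xs) % p
      ≡⟨ cong (_% p) (cong (_+ x * num xs) (*-identityˡ (∏ xs))) ⟨
    (1 * ∏ xs + x * num xs) % p
      ≡⟨ +-cong-mod (*-cong-mod (sym (inverse-correct p x c)) (refl {x = ∏ xs % p})) (*-cong-mod (refl {x = x % p}) (num≡sumInverses*∏ cs)) ⟩
    (x * inverse p x * ∏ xs + x * (sumInverses p xs * ∏ xs)) % p
      ≡⟨ cong (_% p) (eq x (inverse p x) (∏ xs) (sumInverses p xs)) ⟩
    ((inverse p x + sumInverses p xs) * (x * ∏ xs)) % p ∎
    where
    open ≡-Reasoning
    eq : ∀ x y a s → x * y * a + x * (s * a) ≡ (y + s) * (x * a)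
    eq = solve-∀

  -- Both sides are congruent to the common sum of inverses times `∏ xs * ∏ ys`.
  sumInverses-cross : ∀ {m} {xs : Vec ℕ m} {ys : Vec ℕ n} → All (λ x → Coprime x p) xs → All (λ x → Coprime x p) ys →
    sumInverses p xs ≡ sumInverses p ys [mod p ] → num xs * ∏ ys ≡ num ys * ∏ xs [mod p ]
  sumInverses-cross {xs = xs} {ys} cs ds s≡t = begin
    (num xs * ∏ ys) % p
      ≡⟨ *-cong-mod (num≡sumInverses*∏ cs) (refl {x = ∏ ys % p}) ⟩
    (sumInverses p xs * ∏ xs * ∏ ys) % p
      ≡⟨ *-cong-mod (*-cong-mod s≡t (refl {x = ∏ xs % p})) (refl {x = ∏ ys % p}) ⟩
    (sumInverses p ys * ∏ xs * ∏ ys) % p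
      ≡⟨ cong (_% p) (eq (sumInverses p ys) (∏ xs) (∏ ys)) ⟩
    (sumInverses p ys * ∏ ys * ∏ xs) % p
      ≡⟨ *-cong-mod (sym (num≡sumInverses*∏ ds)) (refl {x = ∏ xs % p}) ⟩
    (num ys * ∏ xs) % p ∎
    where
    open ≡-Reasoning
    eq : ∀ a b c → a * b * c ≡ a * c * b
    eq = solve-∀

-- Distinct slopes v/u of lattice points (u, v), u ≤ U, whose determinants
-- are multiples of p differ by at least p/U².
slope-separated : ∀ {u v u′ v′ U} p .{{_ : NonZero (u * p)}} .{{_ : NonZero (u′ * p)}} →
  u ≤ U → u′ ≤ U → u′ * v + p ≤ u * v′ → v * (U * U) /ℕ (u * p) < v′ * (U * U) /ℕ (u′ * p)
slope-separated {u} {v} {u′} {v′} {U} p u≤U u′≤U sep = begin-strict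
  q                               <⟨ n<1+n q ⟩
  suc q                           ≡⟨ m*n/n≡m (suc q) (u′ * p) ⟨
  suc q * (u′ * p) /ℕ (u′ * p)     ≤⟨ /-monoˡ-≤ (u′ * p) (*-cancelˡ-≤ u {{m*n≢0⇒m≢0 u}} scaled) ⟩
  v′ * (U * U) /ℕ (u′ * p)         ∎
  where
  open ≤-Reasoning
  q = v * (U * U) /ℕ (u * p)
  eq₁ : ∀ u q u′ p → u * (suc q * (u′ * p)) ≡ u′ * (q * (u * p)) + u * u′ * p
  eq₁ = solve-∀
  eq₂ : ∀ u′ v U p → u′ * (v * (U * U)) + U * U * p ≡ (u′ * v + p) * (U * U)
  eq₂ = solve-∀
  -- Multiplication by `u` clears the denominators, and `u * u′ ≤ U * U` pays for the extra one in
  -- `suc q`.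
  scaled : u * (suc q * (u′ * p)) ≤ u * (v′ * (U * U))
  scaled = begin
    u * (suc q * (u′ * p))                ≡⟨ eq₁ u q u′ p ⟩
    u′ * (q * (u * p)) + u * u′ * p       ≤⟨ +-mono-≤ (*-monoʳ-≤ u′ (m/n*n≤m (v * (U * U)) (u * p))) (*-monoˡ-≤ p (*-mono-≤ u≤U u′≤U)) ⟩
    u′ * (v * (U * U)) + U * U * p        ≡⟨ eq₂ u′ v U p ⟩
    (u′ * v + p) * (U * U)                ≤⟨ *-monoˡ-≤ (U * U) sep ⟩
    u * v′ * (U * U)                      ≡⟨ *-assoc u v′ (U * U) ⟩
    u * (v′ * (U * U))                    ∎

-- A slope v/u ≤ V/U, multiplied by U²/p, is at most UV/p. The rounded slopes therefore take at most
-- ⌊UV/p⌋ + 1 values.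
slope-bounded : ∀ {u v U V} p .{{_ : NonZero p}} .{{_ : NonZero u}} .{{_ : NonZero (u * p)}} →
  v * U ≤ u * V → v * (U * U) /ℕ (u * p) ≤ U * V /ℕ p
slope-bounded {u} {v} {U} {V} p vU≤uV = begin
  q              ≡⟨ m*n/n≡m q p ⟨
  q * p /ℕ p      ≤⟨ /-monoˡ-≤ p (*-cancelˡ-≤ u scaled) ⟩
  U * V /ℕ p      ∎
  where
  open ≤-Reasoning
  q = v * (U * U) /ℕ (u * p)
  eq₁ : ∀ u q p → u * (q * p) ≡ q * (u * p)
  eq₁ = solve-∀
  eq₂ : ∀ u U V → u * V * U ≡ u * (U * V)
  eq₂ = solve-∀
  scaled : u * (q * p) ≤ u * (U * V)
  scaled = begin
    u * (q * p)         ≡⟨ eq₁ u q p ⟩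
    q * (u * p)         ≤⟨ m/n*n≤m (v * (U * U)) (u * p) ⟩
    v * (U * U)         ≡⟨ *-assoc v U U ⟨
    v * U * U           ≤⟨ *-monoˡ-≤ U vU≤uV ⟩
    u * V * U           ≡⟨ eq₂ u U V ⟩
    u * (U * V)         ∎

-- For nonzero entries this is equality over ℚ of the two sums of reciprocals, cross-multiplied.
SameSum : ∀ {m} → Vec ℕ m → Vec ℕ n → Set
SameSum xs ys = num xs * ∏ ys ≡ num ys * ∏ xs

sameSum? : ∀ {m} (xs : Vec ℕ m) (ys : Vec ℕ n) → Dec (SameSum xs ys)
sameSum? xs ys = _ ≟ _

-- Rational values within a residue class

module _ {p N : ℕ} .{{_ : NonZero p}} (pr : Prime p) (N<p : N < p) .{{_ : NonZero N}} (k : ℕ) where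

  private
    -- Each side of the congruence has `suc k` terms here, so the exponent of `N` in the bound for
    -- numerators, one less than the number of terms, is `k`.
    U V : ℕ
    U = suc k * N ^ k
    V = N ^ suc k

    box : List (Vec ℕ (suc k))
    box = tuples (interval N) (suc k)

    -- `key` is the slope v/u measured in units of p/U² and rounded down.
    residue key : Vec ℕ (suc k) → ℕ
    residue xs = sumInverses p xs % p
    -- suc ∘ pred only makes the divisor syntactically nonzero.
    key xs = ∏ xs * (U * U) /ℕ suc (pred (num xs * p))

    nonZero-entries : ∀ {xs} → xs ∈ box → All NonZero xs
    nonZero-entries xs∈ = All.map (proj₁ ∘ ∈-interval⁻) (∈-tuples⁻ (interval N) (suc k) xs∈)

    entries≤N : ∀ {xs} → xs ∈ box → All (_≤ N) xs
    entries≤N xs∈ = All.map (proj₂ ∘ ∈-interval⁻) (∈-tuples⁻ (interval N) (suc k) xs∈)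

    entries-coprime : ∀ {xs} → xs ∈ box → All (λ x → Coprime x p) xs
    entries-coprime xs∈ = All.map (λ {x} → coprime {x}) (∈-tuples⁻ (interval N) (suc k) xs∈)
      where
      coprime : ∀ {x} → x ∈ interval N → Coprime x p
      coprime x∈ = let x≢0 , x≤N = ∈-interval⁻ x∈ in
        Coprime.sym (prime⇒coprime pr {{x≢0}} (≤-<-trans x≤N N<p))

    num*p≢0 : ∀ {xs} → xs ∈ box → NonZero (num xs * p)
    num*p≢0 {xs} xs∈ = m*n≢0 (num xs) p {{num≢0 (nonZero-entries xs∈)}}

    key≡ : ∀ {xs} (xs∈ : xs ∈ box) → key xs ≡ _/ℕ_ (∏ xs * (U * U)) (num xs * p) {{num*p≢0 xs∈}}
    key≡ {xs} xs∈ = /-congʳ {{_}} {{num*p≢0 xs∈}} (suc-pred (num xs * p) {{num*p≢0 xs∈}})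

    num≤U : ∀ {xs} → xs ∈ box → num xs ≤ U
    num≤U {xs} xs∈ = *-cancelʳ-≤ (num xs) U N (≤-trans (num*N≤n*N^n (entries≤N xs∈)) (≤-reflexive (eq (suc k) N (N ^ k))))
      where
      eq : ∀ k N a → k * (N * a) ≡ k * a * N
      eq = solve-∀

    ∏*U≤num*V : ∀ {xs} → xs ∈ box → ∏ xs * U ≤ num xs * V
    ∏*U≤num*V {xs} xs∈ = begin
      ∏ xs * (suc k * N ^ k)     ≡⟨ eq (∏ xs) (suc k) (N ^ k) ⟩
      suc k * ∏ xs * N ^ k       ≤⟨ *-monoˡ-≤ (N ^ k) (n*∏≤num*N (entries≤N xs∈)) ⟩
      num xs * N * N ^ k         ≡⟨ *-assoc (num xs) N (N ^ k) ⟩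
      num xs * V                 ∎
      where
      open ≤-Reasoning
      eq : ∀ a b c → a * (b * c) ≡ b * a * c
      eq = solve-∀

    key<R : ∀ {xs} → xs ∈ box → key xs < suc (U * V /ℕ p)
    key<R {xs} xs∈ = s≤s (≤-trans (≤-reflexive (key≡ xs∈))
      (slope-bounded {v = ∏ xs} {U} {V} p {{_}} {{num≢0 (nonZero-entries xs∈)}} {{num*p≢0 xs∈}} (∏*U≤num*V xs∈)))

    -- The two cross products are congruent modulo `p`, so the smaller one plus `p` does not exceed
    -- the larger one, as `slope-separated` requires.
    cross<⇒key< : ∀ {xs ys} → xs ∈ box → ys ∈ box → residue xs ≡ residue ys →
                   num ys * ∏ xs < num xs * ∏ ys → key xs < key ys
    cross<⇒key< {xs} {ys} xs∈ ys∈ f≡ lt = subst₂ _<_ (sym (key≡ xs∈)) (sym (key≡ ys∈))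
      (slope-separated {v = ∏ xs} {v′ = ∏ ys} p {{num*p≢0 xs∈}} {{num*p≢0 ys∈}} (num≤U xs∈) (num≤U ys∈)
        (<∧≡-mod⇒+≤ p lt (sym (sumInverses-cross p (entries-coprime xs∈) (entries-coprime ys∈) f≡))))

    residue∧key⇒sameSum : ∀ {xs ys} → xs ∈ box → ys ∈ box → residue xs ≡ residue ys × key xs ≡ key ys → SameSum xs ys
    residue∧key⇒sameSum {xs} {ys} xs∈ ys∈ (f≡ , key≡) with <-cmp (num xs * ∏ ys) (num ys * ∏ xs)
    ... | tri≈ _ eq _ = eq
    ... | tri< lt _ _ = contradiction (sym key≡) (<⇒≢ (cross<⇒key< ys∈ xs∈ (sym f≡) lt))
    ... | tri> _ _ gt = contradiction key≡ (<⇒≢ (cross<⇒key< xs∈ ys∈ f≡ gt))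

  -- Collisions of `residue` are refined by `key`; inside one residue class equal keys leave only
  -- equal rational sums, by trichotomy of the cross products.
  J₂ₖ≤rationalSolutions : J₂ₖ p N (suc k) ≤
    suc (U * V /ℕ p) * ∑ box (λ xs → ∑ box (λ ys → ⟦ sameSum? xs ys ⟧))
  J₂ₖ≤rationalSolutions = begin
    J₂ₖ p N (suc k)
      ≡⟨ length-filter≡∑ (isSolution? p (suc k)) (tuples (interval N) (suc k + suc k)) ⟩
    ∑ (tuples (interval N) (suc k + suc k)) (λ z → ⟦ isSolution? p (suc k) z ⟧)
      ≡⟨ ∑-tuples-+ (interval N) (suc k) (suc k) _ ⟩
    ∑ box (λ xs → ∑ box (λ ys → ⟦ isSolution? p (suc k) (xs ++ ys) ⟧))
      ≡⟨ ∑-cong box (λ xs → ∑-cong box (λ ys → cong₂ (λ s t → ⟦ sumInverses p s % p ≟ sumInverses p t % p ⟧)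
           (take-++ (suc k) xs ys) (drop-++ (suc k) xs ys))) ⟩
    ∑ box (λ xs → ∑ box (λ ys → ⟦ residue xs ≟ residue ys ⟧))
      ≤⟨ collisions-refine box residue key p (suc (U * V /ℕ p)) (λ xs → m%n<n (sumInverses p xs) p) key<R ⟩
    suc (U * V /ℕ p) * ∑ box (λ xs → ∑ box (λ ys → ⟦ (residue xs ≟ residue ys) ×-dec (key xs ≟ key ys) ⟧))
      ≤⟨ *-monoʳ-≤ (suc (U * V /ℕ p)) (∑-mono box λ {xs} xs∈ → ∑-mono box λ {ys} ys∈ →
           ⟦⟧-mono ((residue xs ≟ residue ys) ×-dec (key xs ≟ key ys)) (sameSum? xs ys) (residue∧key⇒sameSum xs∈ ys∈)) ⟩
    suc (U * V /ℕ p) * ∑ box (λ xs → ∑ box (λ ys → ⟦ sameSum? xs ys ⟧)) ∎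
    where
    open ≤-Reasoning

-- Squarefull products

Squarefull : ℕ → Set
Squarefull m = ∀ {q} → Prime q → q ∣ m → q * q ∣ m

-- If `q` divides the head, then `q ∣ num` leaves `q ∣ ∏ xs`, a second factor. Otherwise both
-- divisibilities pass to the tail.
∣∏∧∣num⇒square∣∏ : ∀ {q} → Prime q → (xs : Vec ℕ n) → q ∣ ∏ xs → q ∣ num xs → q * q ∣ ∏ xs
∣∏∧∣num⇒square∣∏ pr []       q∣1 _ = contradiction (subst Prime (∣1⇒≡1 q∣1) pr) ¬prime[1]
∣∏∧∣num⇒square∣∏ {q = q} pr (x ∷ xs) q∣x∏ q∣num with q ∣? x
... | yes q∣x = *-pres-∣ q∣x (∣m+n∣m⇒∣n (subst (q ∣_) (+-comm (∏ xs) _) q∣num) (∣m⇒∣m*n (num xs) q∣x))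
... | no  q∤x = ∣n⇒∣m*n x (∣∏∧∣num⇒square∣∏ pr xs (other (∏ xs) q∣x∏) (other (num xs) (∣m+n∣m⇒∣n q∣num (other (∏ xs) q∣x∏))))
  where
  other : ∀ m → q ∣ x * m → q ∣ m
  other m q∣xm with euclidsLemma x m pr q∣xm
  ... | inj₁ q∣x = contradiction q∣x q∤x
  ... | inj₂ q∣m = q∣m

-- A prime dividing both halves is squared at once. If it divides only one half, the equation makes
-- it divide the numerator of that half too, and the previous lemma applies.
sameSum⇒squarefull : ∀ {m} (xs : Vec ℕ m) (ys : Vec ℕ n) → SameSum xs ys → Squarefull (∏ (xs ++ ys))
sameSum⇒squarefull xs ys eq {q} pr q∣P rewrite ∏-++ xs ys with q ∣? ∏ xs | q ∣? ∏ ys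
... | yes q∣v | yes q∣w = *-pres-∣ q∣v q∣w
... | no  q∤v | no  q∤w with euclidsLemma (∏ xs) (∏ ys) pr q∣P
...   | inj₁ q∣v = contradiction q∣v q∤v
...   | inj₂ q∣w = contradiction q∣w q∤w
sameSum⇒squarefull xs ys eq {q} pr q∣P | yes q∣v | no q∤w
  with euclidsLemma (num xs) (∏ ys) pr (subst (q ∣_) (sym eq) (∣n⇒∣m*n (num ys) q∣v))
... | inj₁ q∣num = ∣m⇒∣m*n (∏ ys) (∣∏∧∣num⇒square∣∏ pr xs q∣v q∣num)
... | inj₂ q∣w   = contradiction q∣w q∤w
sameSum⇒squarefull xs ys eq {q} pr q∣P | no q∤v | yes q∣w
  with euclidsLemma (num ys) (∏ xs) pr (subst (q ∣_) eq (∣n⇒∣m*n (num xs) q∣w))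
... | inj₁ q∣num = ∣n⇒∣m*n (∏ xs) (∣∏∧∣num⇒square∣∏ pr ys q∣w q∣num)
... | inj₂ q∣v   = contradiction q∣v q∤v

-- Entrywise products and patterns of parameters

infixr 7 _⊙_

_⊙_ : Vec ℕ n → Vec ℕ n → Vec ℕ n
_⊙_ = zipWith _*_

ones : Vec ℕ n
ones {n} = replicate n 1

⊙-assoc : ∀ (x y z : Vec ℕ n) → (x ⊙ y) ⊙ z ≡ x ⊙ (y ⊙ z)
⊙-assoc = zipWith-assoc *-assoc

⊙-comm : ∀ (x y : Vec ℕ n) → x ⊙ y ≡ y ⊙ x
⊙-comm = zipWith-comm *-comm

⊙-identityˡ : ∀ (x : Vec ℕ n) → ones ⊙ x ≡ x
⊙-identityˡ = zipWith-identityˡ *-identityˡ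

⊙-swap : ∀ (x y z : Vec ℕ n) → x ⊙ (y ⊙ z) ≡ y ⊙ (x ⊙ z)
⊙-swap x y z = trans (sym (⊙-assoc x y z)) (trans (cong (_⊙ z) (⊙-comm x y)) (⊙-assoc y x z))

⊙-interchange : ∀ (w x y z : Vec ℕ n) → (w ⊙ x) ⊙ (y ⊙ z) ≡ (w ⊙ y) ⊙ (x ⊙ z)
⊙-interchange w x y z = trans (⊙-assoc w x (y ⊙ z)) (trans (cong (w ⊙_) (⊙-swap x y z)) (sym (⊙-assoc w y (x ⊙ z))))

∏-⊙ : ∀ (x y : Vec ℕ n) → ∏ (x ⊙ y) ≡ ∏ x * ∏ y
∏-⊙ []       []       = refl
∏-⊙ (a ∷ x) (b ∷ y) = trans (cong (a * b *_) (∏-⊙ x y)) (eq a b (∏ x) (∏ y))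
  where
  eq : ∀ a b c d → a * b * (c * d) ≡ a * c * (b * d)
  eq = solve-∀

∏-ones : ∀ n → ∏ (ones {n}) ≡ 1
∏-ones zero    = refl
∏-ones (suc n) = trans (+-identityʳ _) (∏-ones n)

∏≡1⇒≡ones : ∀ (z : Vec ℕ n) → ∏ z ≡ 1 → z ≡ ones
∏≡1⇒≡ones []       _  = refl
∏≡1⇒≡ones (x ∷ z) eq = cong₂ _∷_ (m*n≡1⇒m≡1 x (∏ z) eq) (∏≡1⇒≡ones z (m*n≡1⇒n≡1 x (∏ z) eq))

single : Fin n → ℕ → Vec ℕ n
single zero    q = q ∷ ones
single (suc a) q = 1 ∷ single a q

∏-single : ∀ (a : Fin n) q → ∏ (single a q) ≡ q
∏-single {suc n} zero    q = trans (cong (q *_) (∏-ones n)) (*-identityʳ q)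
∏-single         (suc a) q = trans (+-identityʳ _) (∏-single a q)

single-1 : ∀ (a : Fin n) → single a 1 ≡ ones
single-1 zero    = refl
single-1 (suc a) = cong (1 ∷_) (single-1 a)

single-* : ∀ (a : Fin n) q r → single a (q * r) ≡ single a q ⊙ single a r
single-* zero    q r = cong (q * r ∷_) (sym (⊙-identityˡ ones))
single-* (suc a) q r = cong (1 ∷_) (single-* a q r)

∣∏⇒single : ∀ {q} → Prime q → (z : Vec ℕ n) → q ∣ ∏ z → ∃[ a ] ∃[ z′ ] z ≡ single a q ⊙ z′
∣∏⇒single pr []       q∣1 = contradiction (subst Prime (∣1⇒≡1 q∣1) pr) ¬prime[1]
∣∏⇒single {q = q} pr (x ∷ z) q∣ with euclidsLemma x (∏ z) pr q∣
... | inj₁ (divides c refl) = zero , c ∷ z , cong₂ _∷_ (*-comm c q) (sym (⊙-identityˡ z))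
... | inj₂ q∣∏z with a , z′ , refl ← ∣∏⇒single pr z q∣∏z = suc a , x ∷ z′ , cong (_∷ _) (sym (*-identityˡ x))

-- The positions, possibly coinciding, at which one parameter enters the tuple.
data Pattern (n : ℕ) : Set where
  square : (a b : Fin n) → Pattern n
  cube   : (a b c : Fin n) → Pattern n

degree : Pattern n → ℕ
degree (square _ _) = 2
degree (cube _ _ _) = 3

monomial : Pattern n → ℕ → Vec ℕ n
monomial (square a b) m = single a m ⊙ single b m
monomial (cube a b c) m = single a m ⊙ single b m ⊙ single c m

∏-monomial : ∀ (s : Pattern n) m → ∏ (monomial s m) ≡ m ^ degree s
∏-monomial (square a b) m = trans (∏-⊙ (single a m) (single b m))
  (cong₂ _*_ (∏-single a m) (trans (∏-single b m) (sym (*-identityʳ m))))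
∏-monomial (cube a b c) m = trans (∏-⊙ (single a m) (single b m ⊙ single c m))
  (cong₂ _*_ (∏-single a m) (∏-monomial (square b c) m))

monomial-1 : ∀ (s : Pattern n) → monomial s 1 ≡ ones
monomial-1 (square a b) = trans (cong₂ _⊙_ (single-1 a) (single-1 b)) (⊙-identityˡ ones)
monomial-1 (cube a b c) = trans (cong₂ _⊙_ (single-1 a) (monomial-1 (square b c))) (⊙-identityˡ ones)

monomial-* : ∀ (s : Pattern n) q r → monomial s (q * r) ≡ monomial s q ⊙ monomial s r
monomial-* (square a b) q r = trans (cong₂ _⊙_ (single-* a q r) (single-* b q r))
  (⊙-interchange (single a q) (single a r) (single b q) (single b r))
monomial-* (cube a b c) q r = trans (cong₂ _⊙_ (single-* a q r) (monomial-* (square b c) q r))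
  (⊙-interchange (single a q) (single a r) (single b q ⊙ single c q) (single b r ⊙ single c r))

-- One nonzero parameter for each pattern of the list. A tuple may have several such
-- representations, which does no harm to an upper bound.
data Spanned {n} : List (Pattern n) → Vec ℕ n → Set where
  []  : Spanned [] ones
  _∷_ : ∀ {s ps m z} → NonZero m → Spanned ps z → Spanned (s ∷ ps) (monomial s m ⊙ z)

spanned-ones : ∀ (ps : List (Pattern n)) → Spanned ps ones
spanned-ones []       = []
spanned-ones (s ∷ ps) = subst (Spanned (s ∷ ps))
  (trans (cong (_⊙ ones) (monomial-1 s)) (⊙-identityˡ ones))
  (_∷_ {s = s} {m = 1} _ (spanned-ones ps))

-- `monomial s` is multiplicative in its parameter, so `q` is absorbed by the parameter already
-- present for `s`.
spanned-⊙ : ∀ {ps} {s : Pattern n} {z} q .{{_ : NonZero q}} → s ∈ ps → Spanned ps z → Spanned ps (monomial s q ⊙ z)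
spanned-⊙ {ps = s ∷ ps} q (here refl) (_∷_ {m = m} {z} m≢0 sp) =
  subst (Spanned (s ∷ ps)) (trans (cong (_⊙ z) (monomial-* s q m)) (⊙-assoc (monomial s q) (monomial s m) z))
    (_∷_ {m = q * m} (m*n≢0 q m {{it}} {{m≢0}}) sp)
spanned-⊙ {ps = t ∷ ps} {s} q (there s∈ps) (_∷_ {m = m} {z} m≢0 sp) =
  subst (Spanned (t ∷ ps)) (⊙-swap (monomial t m) (monomial s q) z) (m≢0 ∷ spanned-⊙ q s∈ps sp)

spanned⇒∏≢0 : ∀ {ps} {z : Vec ℕ n} → Spanned ps z → NonZero (∏ z)
spanned⇒∏≢0 {n} [] = subst NonZero (sym (∏-ones n)) _
spanned⇒∏≢0 (_∷_ {s} {_} {m} {z} m≢0 sp) = subst NonZero (sym (∏-⊙ (monomial s m) z))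
  (m*n≢0 _ _ {{subst NonZero (sym (∏-monomial s m)) (m^n≢0 m (degree s) {{m≢0}})}} {{spanned⇒∏≢0 sp}})

squares cubes allPatterns : ∀ n → List (Pattern n)
squares n = cartesianProductWith square (allFin n) (allFin n)
cubes   n = cartesianProductWith (λ f c → f c) (cartesianProductWith cube (allFin n) (allFin n)) (allFin n)
allPatterns n = squares n List.++ cubes n

square∈allPatterns : ∀ (a b : Fin n) → square a b ∈ allPatterns n
square∈allPatterns a b = ∈-++⁺ˡ (∈-cartesianProductWith⁺ square (∈-allFin a) (∈-allFin b))

cube∈allPatterns : ∀ (a b c : Fin n) → cube a b c ∈ allPatterns n
cube∈allPatterns {n} a b c = ∈-++⁺ʳ (squares n)
  (∈-cartesianProductWith⁺ (λ f c → f c) (∈-cartesianProductWith⁺ cube (∈-allFin a) (∈-allFin b)) (∈-allFin c))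

-- Splitting off primes in twos and threes

SquarefullAwayFrom : ℕ → ℕ → Set
SquarefullAwayFrom q m = ∀ {r} → Prime r → r ≢ q → r ∣ m → r * r ∣ m

-- For m = c·r, cancelling `r` from r² ∣ q·c·r leaves r ∣ q·c, and a prime `r` other than `q`
-- divides `c`. Thus the other primes keep their squares while copies of `q` are removed.
squarefullAwayFrom-cancel : ∀ {q} m → Prime q → SquarefullAwayFrom q (q * m) → SquarefullAwayFrom q m
squarefullAwayFrom-cancel {q} m pq sf {r} pr r≢q r∣m@(divides c refl) = *-pres-∣ {o = r} r∣c ∣-refl
  where
  instance _ = prime⇒nonZero pr
  r∣qc : r ∣ q * c
  r∣qc = *-cancelʳ-∣ r (subst (r * r ∣_) (sym (*-assoc q c r)) (sf pr r≢q (∣n⇒∣m*n q r∣m)))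
  r∣c : r ∣ c
  r∣c with euclidsLemma q c pr r∣qc
  ... | inj₂ r∣c = r∣c
  ... | inj₁ r∣q with prime⇒irreducible pq r∣q
  ...   | inj₁ r≡1 = contradiction (subst Prime r≡1 pr) ¬prime[1]
  ...   | inj₂ r≡q = contradiction r≡q r≢q

squarefullAwayFrom⇒squarefull : ∀ {q m} → SquarefullAwayFrom q m → (q ∣ m → q * q ∣ m) → Squarefull m
squarefullAwayFrom⇒squarefull {q} sf at-q {r} pr r∣m with r ≟ q
... | yes refl = at-q r∣m
... | no  r≢q  = sf pr r≢q r∣m

primeDivisor : ∀ m .{{_ : NonZero m}} → m ≢ 1 → ∃[ q ] Prime q × q ∣ m
primeDivisor m m≢1 with factorise m
... | record { factors = []     ; isFactorisation = eq } = contradiction eq m≢1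
... | record { factors = q ∷ qs ; isFactorisation = eq ; factorsPrime = pr ListAll.∷ _ } =
  q , pr , subst (q ∣_) (sym eq) (m∣m*n _)

-- Every prime is removed in pairs, except that three copies are removed
-- when exactly three are left.
squarefull⇒spanned : ∀ (z : Vec ℕ n) → NonZero (∏ z) → Squarefull (∏ z) → Spanned (allPatterns n) z
squarefull⇒spanned {n} z = go z (<-wellFounded (∏ z))
  where
  ps = allPatterns n
  go : ∀ z → Acc _<_ (∏ z) → NonZero (∏ z) → Squarefull (∏ z) → Spanned ps z
  go z (acc rec) P≢0 sf with ∏ z ≟ 1
  ... | yes P≡1 = subst (Spanned ps) (sym (∏≡1⇒≡ones z P≡1)) (spanned-ones ps)
  ... | no  P≢1
    with q , pq , q∣P ← primeDivisor (∏ z) {{P≢0}} P≢1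
    with a , z₁ , refl ← ∣∏⇒single pq z q∣P
    with P≡ ← trans (∏-⊙ (single a q) z₁) (cong (_* ∏ z₁) (∏-single a q))
    -- The square of `q` divides the product, so after one factor is taken out at position `a`
    -- another remains in `z₁`.
    with b , z₂ , refl ← ∣∏⇒single pq z₁ (*-cancelˡ-∣ q {{prime⇒nonZero pq}} (subst (q * q ∣_) P≡ (sf pq q∣P)))
    with P₁≡ ← trans (∏-⊙ (single b q) z₂) (cong (_* ∏ z₂) (∏-single b q))
    = remaining (q ∣? ∏ z₂) (q * q ∣? ∏ z₂)
    where
    instance
      q≢0 = prime⇒nonZero pq

    P≡qqP₂ : ∏ (single a q ⊙ single b q ⊙ z₂) ≡ q * (q * ∏ z₂)
    P≡qqP₂ = trans P≡ (cong (q *_) P₁≡)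

    P₂≢0 : NonZero (∏ z₂)
    P₂≢0 = m*n≢0⇒n≢0 q {{m*n≢0⇒n≢0 q {{subst NonZero P≡qqP₂ P≢0}}}}

    P₂<P : ∏ z₂ < ∏ (single a q ⊙ single b q ⊙ z₂)
    P₂<P = subst (∏ z₂ <_) (sym P≡qqP₂) (<-≤-trans (m<m*n (∏ z₂) q {{P₂≢0}} (nonTrivial⇒n>1 q {{prime⇒nonTrivial pq}}))
      (≤-trans (≤-reflexive (*-comm (∏ z₂) q)) (m≤n*m (q * ∏ z₂) q)))

    sf₂ : SquarefullAwayFrom q (∏ z₂)
    sf₂ = squarefullAwayFrom-cancel _ pq (squarefullAwayFrom-cancel _ pq
            (λ {r} pr _ → subst (λ m → r ∣ m → r * r ∣ m) P≡qqP₂ (sf pr)))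

    removeTwo : (q ∣ ∏ z₂ → q * q ∣ ∏ z₂) → Spanned ps (single a q ⊙ single b q ⊙ z₂)
    removeTwo at-q = subst (Spanned ps) (⊙-assoc (single a q) (single b q) z₂)
      (spanned-⊙ q (square∈allPatterns a b) (go z₂ (rec P₂<P) P₂≢0 (squarefullAwayFrom⇒squarefull sf₂ at-q)))

    remaining : Dec (q ∣ ∏ z₂) → Dec (q * q ∣ ∏ z₂) → Spanned ps (single a q ⊙ single b q ⊙ z₂)
    remaining (no q∤P₂)  _          = removeTwo (λ q∣P₂ → contradiction q∣P₂ q∤P₂)
    remaining (yes _)    (yes qq∣P₂) = removeTwo (λ _ → qq∣P₂)
    -- Here `q` divides what is left exactly once. Removing this third copy as well leaves a product
    -- prime to `q`, so squarefullness is restored.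
    remaining (yes q∣P₂) (no qq∤P₂)
      with c , z₃ , z₂≡ ← ∣∏⇒single pq z₂ q∣P₂
      with P₂≡ ← trans (cong ∏ z₂≡) (trans (∏-⊙ (single c q) z₃) (cong (_* ∏ z₃) (∏-single c q)))
      = subst (Spanned ps) (trans (⊙-assoc (single a q) _ z₃) (cong (single a q ⊙_)
            (trans (⊙-assoc (single b q) _ z₃) (cong (single b q ⊙_) (sym z₂≡)))))
          (spanned-⊙ q (cube∈allPatterns a b c) (go z₃ (rec P₃<P)
            (m*n≢0⇒n≢0 q {{subst NonZero P₂≡ P₂≢0}})
            (squarefullAwayFrom⇒squarefull
              (squarefullAwayFrom-cancel _ pq (λ {r} pr r≢q → subst (λ m → r ∣ m → r * r ∣ m) P₂≡ (sf₂ pr r≢q)))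
              (λ q∣P₃ → contradiction (subst (q * q ∣_) (sym P₂≡) (*-monoʳ-∣ q q∣P₃)) qq∤P₂))))
      where
      P₃<P : ∏ z₃ < ∏ (single a q ⊙ single b q ⊙ z₂)
      P₃<P = ≤-<-trans (≤-trans (m≤n*m (∏ z₃) q) (≤-reflexive (sym P₂≡))) P₂<P

-- Counting products of patterns

length-concatMap : ∀ (f : A → List B) xs → length (concatMap f xs) ≡ ∑ xs (length ∘ f)
length-concatMap f []       = refl
length-concatMap f (x ∷ xs) = trans (length-++ (f x)) (cong (length (f x) ℕ.+_) (length-concatMap f xs))

∈-concatMap′ : ∀ (f : A → List B) {xs x y} → x ∈ xs → y ∈ f x → y ∈ concatMap f xs
∈-concatMap′ f x∈ y∈ = ∈-concatMap⁺ f (Any.map (λ { refl → y∈ }) x∈)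

length-cartesianProductWith : ∀ {C : Set} (f : A → B → C) xs ys →
  length (cartesianProductWith f xs ys) ≡ length xs * length ys
length-cartesianProductWith f []       ys = refl
length-cartesianProductWith f (x ∷ xs) ys = trans (length-++ (map (f x) ys))
  (cong₂ _+_ (length-map (f x) ys) (length-cartesianProductWith f xs ys))

-- The scale of a parameter m in [4ʲ, 4ʲ⁺¹) is scale s j ≤ m ^ (degree s / 2).
scale : Pattern n → ℕ → ℕ
scale s j = (2 ^ degree s) ^ j

scale² : ∀ (s : Pattern n) j → scale s j * scale s j ≡ (4 ^ j) ^ degree s
scale² s j = begin
  (2 ^ d) ^ j * (2 ^ d) ^ j     ≡⟨ cong₂ _*_ (^-*-assoc 2 d j) (^-*-assoc 2 d j) ⟩
  2 ^ (d * j) * 2 ^ (d * j)     ≡⟨ ^-distribˡ-+-* 2 (d * j) (d * j) ⟨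
  2 ^ (d * j + d * j)           ≡⟨ cong (2 ^_) (eq d j) ⟩
  2 ^ (2 * j * d)               ≡⟨ ^-*-assoc 2 (2 * j) d ⟨
  (2 ^ (2 * j)) ^ d             ≡⟨ cong (_^ d) (^-*-assoc 2 2 j) ⟨
  (4 ^ j) ^ d                   ∎
  where
  open ≡-Reasoning
  d = degree s
  eq : ∀ d j → d * j + d * j ≡ 2 * j * d
  eq = solve-∀

block : ℕ → List ℕ
block j = applyUpTo (4 ^ j ℕ.+_) (3 * 4 ^ j)

∈-block : ∀ {j m} → 4 ^ j ≤ m → m < 4 ^ suc j → m ∈ block j
∈-block {j} {m} lo hi = subst (_∈ block j) (m+[n∸m]≡n lo)
  (∈-applyUpTo⁺ (4 ^ j ℕ.+_) (+-cancelˡ-< (4 ^ j) _ _ (subst₂ _<_ (sym (m+[n∸m]≡n lo)) refl hi)))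

log-floor : ∀ c L {m} .{{_ : NonZero m}} → m < c ^ L → ∃[ j ] j < L × c ^ j ≤ m × m < c ^ suc j
log-floor c zero    {suc m} (s≤s ())
log-floor c (suc L) {m} m< with c ^ L ≤? m
... | yes lo = L , n<1+n L , lo , m<
... | no  hi with j , j<L , lo , hi ← log-floor c L (≰⇒> hi) = j , m<n⇒m<1+n j<L , lo , hi

-- This is ⌊Y / bʲ⌋, computed by repeated division so that sums over `j` satisfy the recursion
-- `∑-÷-suc` in `Y`.
_÷_^_ : ℕ → (b : ℕ) .{{_ : NonZero b}} → ℕ → ℕ
Y ÷ b ^ zero  = Y
Y ÷ b ^ suc j = (Y /ℕ b) ÷ b ^ j

÷-≤ : ∀ Y b .{{_ : NonZero b}} j → Y ÷ b ^ j ≤ Y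
÷-≤ Y b zero    = ≤-refl
÷-≤ Y b (suc j) = ≤-trans (÷-≤ (Y /ℕ b) b j) (m/n≤m Y b)

m<n*suc[m/n] : ∀ m n .{{_ : NonZero n}} → m < n * suc (m /ℕ n)
m<n*suc[m/n] m n = begin-strict
  m                      ≡⟨ m≡m%n+[m/n]*n m n ⟩
  m % n + m /ℕ n * n      <⟨ +-monoˡ-< (m /ℕ n * n) (m%n<n m n) ⟩
  suc (m /ℕ n) * n        ≡⟨ *-comm (suc (m /ℕ n)) n ⟩
  n * suc (m /ℕ n)        ∎
  where open ≤-Reasoning

<-^*suc[÷] : ∀ Y b .{{_ : NonZero b}} j → Y < b ^ j * suc (Y ÷ b ^ j)
<-^*suc[÷] Y b zero    = ≤-reflexive (sym (*-identityˡ (suc Y)))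
<-^*suc[÷] Y b (suc j) = begin-strict
  Y                                          <⟨ m<n*suc[m/n] Y b ⟩
  b * suc (Y /ℕ b)                            ≤⟨ *-monoʳ-≤ b (<-^*suc[÷] (Y /ℕ b) b j) ⟩
  b * (b ^ j * suc (Y ÷ b ^ suc j))          ≡⟨ *-assoc b (b ^ j) _ ⟨
  b ^ suc j * suc (Y ÷ b ^ suc j)            ∎
  where open ≤-Reasoning

∑-÷-suc : ∀ c b .{{_ : NonZero b}} L Y → ∑ (upTo (suc L)) (λ j → c ^ j * (Y ÷ b ^ j)) ≡
          Y + c * ∑ (upTo L) (λ j → c ^ j * ((Y /ℕ b) ÷ b ^ j))
∑-÷-suc c b L Y = begin
  ∑ (upTo (suc L)) (λ j → c ^ j * (Y ÷ b ^ j))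
    ≡⟨ ∑-upTo-suc L (λ j → c ^ j * (Y ÷ b ^ j)) ⟩
  1 * Y + ∑ (upTo L) (λ j → c * c ^ j * ((Y /ℕ b) ÷ b ^ j))
    ≡⟨ cong₂ _+_ (*-identityˡ Y) (∑-cong (upTo L) λ j → *-assoc c (c ^ j) _) ⟩
  Y + ∑ (upTo L) (λ j → c * (c ^ j * ((Y /ℕ b) ÷ b ^ j)))
    ≡⟨ cong (Y ℕ.+_) (∑-distribˡ-* (upTo L) c _) ⟨
  Y + c * ∑ (upTo L) (λ j → c ^ j * ((Y /ℕ b) ÷ b ^ j)) ∎
  where open ≡-Reasoning

-- Every scale contributes at most `Y`. This is why a parameter occurring twice costs a logarithm.
∑-4^*÷4^ : ∀ L Y → ∑ (upTo L) (λ j → 4 ^ j * (Y ÷ 4 ^ j)) ≤ L * Y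
∑-4^*÷4^ zero    Y = z≤n
∑-4^*÷4^ (suc L) Y = begin
  ∑ (upTo (suc L)) (λ j → 4 ^ j * (Y ÷ 4 ^ j))               ≡⟨ ∑-÷-suc 4 4 L Y ⟩
  Y + 4 * ∑ (upTo L) (λ j → 4 ^ j * ((Y /ℕ 4) ÷ 4 ^ j))       ≤⟨ +-monoʳ-≤ Y (*-monoʳ-≤ 4 (∑-4^*÷4^ L (Y /ℕ 4))) ⟩
  Y + 4 * (L * (Y /ℕ 4))                                      ≡⟨ cong (Y ℕ.+_) (eq L (Y /ℕ 4)) ⟩
  Y + L * (Y /ℕ 4 * 4)                                        ≤⟨ +-monoʳ-≤ Y (*-monoʳ-≤ L (m/n*n≤m Y 4)) ⟩
  Y + L * Y                                                  ∎
  where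
  open ≤-Reasoning
  eq : ∀ L q → 4 * (L * q) ≡ L * (q * 4)
  eq = solve-∀

-- The summands are at most Y/2ʲ, so the number of scales drops out. This is the convergence of ∑
-- n^(-3/2), grouped by powers of 4.
∑-4^*÷8^ : ∀ L Y → ∑ (upTo L) (λ j → 4 ^ j * (Y ÷ 8 ^ j)) ≤ 2 * Y
∑-4^*÷8^ zero    Y = z≤n
∑-4^*÷8^ (suc L) Y = begin
  ∑ (upTo (suc L)) (λ j → 4 ^ j * (Y ÷ 8 ^ j))               ≡⟨ ∑-÷-suc 4 8 L Y ⟩
  Y + 4 * ∑ (upTo L) (λ j → 4 ^ j * ((Y /ℕ 8) ÷ 8 ^ j))       ≤⟨ +-monoʳ-≤ Y (*-monoʳ-≤ 4 (∑-4^*÷8^ L (Y /ℕ 8))) ⟩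
  Y + 4 * (2 * (Y /ℕ 8))                                      ≡⟨ cong (Y ℕ.+_) (eq (Y /ℕ 8)) ⟩
  Y + Y /ℕ 8 * 8                                              ≤⟨ +-monoʳ-≤ Y (m/n*n≤m Y 8) ⟩
  Y + Y                                                      ≡⟨ cong (Y ℕ.+_) (+-identityʳ Y) ⟨
  2 * Y                                                      ∎
  where
  open ≤-Reasoning
  eq : ∀ q → 4 * (2 * q) ≡ q * 8
  eq = solve-∀

-- ⌊Y / scale s j⌋, the room left for the remaining parameters.
scaleDown : Pattern n → ℕ → ℕ → ℕ
scaleDown (square _ _) j Y = Y ÷ 4 ^ j
scaleDown (cube _ _ _) j Y = Y ÷ 8 ^ j

scaleDown-≤ : ∀ (s : Pattern n) j Y → scaleDown s j Y ≤ Y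
scaleDown-≤ (square _ _) j Y = ÷-≤ Y 4 j
scaleDown-≤ (cube _ _ _) j Y = ÷-≤ Y 8 j

<-scale*suc[scaleDown] : ∀ (s : Pattern n) j Y → Y < scale s j * suc (scaleDown s j Y)
<-scale*suc[scaleDown] (square _ _) j Y = <-^*suc[÷] Y 4 j
<-scale*suc[scaleDown] (cube _ _ _) j Y = <-^*suc[÷] Y 8 j

-- The factor by which a parameter of this pattern enlarges the count: 3·4ʲ values on scale `j`,
-- summed over the scales by `∑-scaleDown`.
cost : ℕ → Pattern n → ℕ
cost L (square _ _) = 3 * L
cost L (cube _ _ _) = 6

∑-scaleDown : ∀ (s : Pattern n) L Y → 3 * ∑ (upTo L) (λ j → 4 ^ j * scaleDown s j Y) ≤ cost L s * Y
∑-scaleDown (square _ _) L Y = ≤-trans (*-monoʳ-≤ 3 (∑-4^*÷4^ L Y)) (≤-reflexive (sym (*-assoc 3 L Y)))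
∑-scaleDown (cube _ _ _) L Y = ≤-trans (*-monoʳ-≤ 3 (∑-4^*÷8^ L Y)) (≤-reflexive (sym (*-assoc 3 2 Y)))

-- A list of candidates, possibly with repetitions, that contains every spanned tuple with product
-- below (Y + 1)², provided (Y + 1)² ≤ 4^L. Thus `Y` bounds the square root of the product, and `L`
-- is the number of scales.
spannedBelow : ℕ → List (Pattern n) → ℕ → List (Vec ℕ n)
-- For `Y = 0` the product would have to be below 1, which excludes `ones`; the empty list keeps the
-- length at most `Y`.
spannedBelow L []       zero    = []
spannedBelow L []       (suc Y) = [ ones ]
spannedBelow L (s ∷ ps) Y       = concatMap (λ j → concatMap (λ m →
  map (monomial s m ⊙_) (spannedBelow L ps (scaleDown s j Y))) (block j)) (upTo L)

length-spannedBelow : ∀ L (ps : List (Pattern n)) Y →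
                      length (spannedBelow L ps Y) ≤ product (map (cost L) ps) * Y
length-spannedBelow L []       zero    = z≤n
length-spannedBelow L []       (suc Y) = s≤s z≤n
length-spannedBelow L (s ∷ ps) Y       = begin
  length (spannedBelow L (s ∷ ps) Y)
    ≡⟨ length-concatMap _ (upTo L) ⟩
  ∑ (upTo L) (λ j → length (concatMap (λ m → map (monomial s m ⊙_) (rest j)) (block j)))
    ≡⟨ ∑-cong (upTo L) (λ j → trans (length-concatMap _ (block j))
         (trans (∑-cong (block j) λ m → length-map (monomial s m ⊙_) (rest j))
         (trans (∑-const (block j) (length (rest j))) (cong (_* length (rest j)) (length-applyUpTo (4 ^ j ℕ.+_) (3 * 4 ^ j)))))) ⟩
  ∑ (upTo L) (λ j → 3 * 4 ^ j * length (rest j))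
    ≤⟨ ∑-mono (upTo L) (λ {j} _ → *-monoʳ-≤ (3 * 4 ^ j) (length-spannedBelow L ps (scaleDown s j Y))) ⟩
  ∑ (upTo L) (λ j → 3 * 4 ^ j * (K * (scaleDown s j Y)))
    ≡⟨ ∑-cong (upTo L) (λ j → eq (4 ^ j) K (scaleDown s j Y)) ⟩
  ∑ (upTo L) (λ j → K * 3 * (4 ^ j * (scaleDown s j Y)))
    ≡⟨ ∑-distribˡ-* (upTo L) (K * 3) _ ⟨
  K * 3 * ∑ (upTo L) (λ j → 4 ^ j * (scaleDown s j Y))
    ≡⟨ *-assoc K 3 _ ⟩
  K * (3 * ∑ (upTo L) (λ j → 4 ^ j * (scaleDown s j Y)))
    ≤⟨ *-monoʳ-≤ K (∑-scaleDown s L Y) ⟩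
  K * (cost L s * Y)
    ≡⟨ eq′ K (cost L s) Y ⟩
  cost L s * K * Y ∎
  where
  open ≤-Reasoning
  K = product (map (cost L) ps)
  rest : ℕ → List (Vec ℕ _)
  rest j = spannedBelow L ps (scaleDown s j Y)
  eq : ∀ a K y → 3 * a * (K * y) ≡ K * 3 * (a * y)
  eq = solve-∀
  eq′ : ∀ K c Y → K * (c * Y) ≡ c * K * Y
  eq′ = solve-∀

-- A parameter m ≥ 4ʲ takes at least the square of `scale s j` out of the product, while Y + 1 ≤
-- scale s j · (Y′ + 1) for the reduced bound Y′. The remaining product is therefore below (Y′ +
-- 1)².
spanned⇒∈spannedBelow : ∀ L {ps} {z : Vec ℕ n} Y → Spanned ps z → ∏ z < suc Y * suc Y → suc Y * suc Y ≤ 4 ^ L →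
                        z ∈ spannedBelow L ps Y
spanned⇒∈spannedBelow {n} L zero [] ∏<1 _ = contradiction (subst (_< 1) (∏-ones n) ∏<1) λ { (s≤s ()) }
spanned⇒∈spannedBelow     L (suc Y) [] _ _ = here refl
spanned⇒∈spannedBelow {n} L {s ∷ ps} Y (_∷_ {m = m} {z} m≢0 sp) ∏< ≤4^L
  = let j , j<L , lo , hi = log-floor 4 L {m} {{m≢0}} m<4^L in
    ∈-concatMap′ _ (∈-upTo⁺ j<L) (∈-concatMap′ (λ m → map (monomial s m ⊙_) (spannedBelow L ps (scaleDown s j Y)))
      (∈-block {j} lo hi) (∈-map⁺ (monomial s m ⊙_) (rest j lo)))
  where
  open ≤-Reasoning
  d = degree s

  m≤m^d : ∀ (s : Pattern n) → m ≤ m ^ degree s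
  m≤m^d (square _ _) = m≤m*n m (m ^ 1) {{m^n≢0 m 1 {{m≢0}}}}
  m≤m^d (cube _ _ _) = m≤m*n m (m ^ 2) {{m^n≢0 m 2 {{m≢0}}}}

  ∏≡ : ∏ (monomial s m ⊙ z) ≡ m ^ d * ∏ z
  ∏≡ = trans (∏-⊙ (monomial s m) z) (cong (_* ∏ z) (∏-monomial s m))

  m<4^L : m < 4 ^ L
  m<4^L = begin-strict
    m                          ≤⟨ m≤m^d s ⟩
    m ^ d                      ≤⟨ m≤m*n (m ^ d) (∏ z) {{spanned⇒∏≢0 sp}} ⟩
    m ^ d * ∏ z                ≡⟨ ∏≡ ⟨
    ∏ (monomial s m ⊙ z)       <⟨ ∏< ⟩
    suc Y * suc Y              ≤⟨ ≤4^L ⟩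
    4 ^ L                      ∎

  rest : ∀ j → 4 ^ j ≤ m → z ∈ spannedBelow L ps (scaleDown s j Y)
  rest j lo = spanned⇒∈spannedBelow L Y′ sp
    (*-cancelˡ-< (c * c) _ _ (begin-strict
      c * c * ∏ z                         ≡⟨ cong (_* ∏ z) (scale² s j) ⟩
      (4 ^ j) ^ d * ∏ z                   ≤⟨ *-monoˡ-≤ (∏ z) (^-monoˡ-≤ d lo) ⟩
      m ^ d * ∏ z                         ≡⟨ ∏≡ ⟨
      ∏ (monomial s m ⊙ z)                <⟨ ∏< ⟩
      suc Y * suc Y                       ≤⟨ *-mono-≤ (<-scale*suc[scaleDown] s j Y) (<-scale*suc[scaleDown] s j Y) ⟩
      c * suc Y′ * (c * suc Y′)           ≡⟨ eq c (suc Y′) ⟩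
      c * c * (suc Y′ * suc Y′)           ∎))
    (≤-trans (*-mono-≤ (s≤s (scaleDown-≤ s j Y)) (s≤s (scaleDown-≤ s j Y))) ≤4^L)
    where
    c = scale s j
    Y′ = scaleDown s j Y
    eq : ∀ c y → c * y * (c * y) ≡ c * c * (y * y)
    eq = solve-∀

-- The number of solutions over ℚ

product-const : ∀ (f : A → ℕ) {c} xs → (∀ {x} → x ∈ xs → f x ≡ c) → product (map f xs) ≡ c ^ length xs
product-const f []       eq = refl
product-const f (x ∷ xs) eq = cong₂ _*_ (eq (here refl)) (product-const f xs (eq ∘ there))

product-cost : ∀ L n → product (map (cost L) (allPatterns n)) ≡ (3 * L) ^ (n * n) * 6 ^ (n * n * n)
product-cost L n = begin
  product (map (cost L) (squares n List.++ cubes n))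
    ≡⟨ cong product (map-++ (cost L) (squares n) (cubes n)) ⟩
  product (map (cost L) (squares n) List.++ map (cost L) (cubes n))
    ≡⟨ product-++ (map (cost L) (squares n)) _ ⟩
  product (map (cost L) (squares n)) * product (map (cost L) (cubes n))
    ≡⟨ cong₂ _*_ (product-const (cost L) (squares n) square-cost) (product-const (cost L) (cubes n) cube-cost) ⟩
  (3 * L) ^ length (squares n) * 6 ^ length (cubes n)
    ≡⟨ cong₂ (λ a b → (3 * L) ^ a * 6 ^ b) (length-fins² square)
         (trans (length-cartesianProductWith (λ f c → f c) (cartesianProductWith cube (allFin n) (allFin n)) (allFin n))
           (cong₂ _*_ (length-fins² cube) (length-tabulate {n = n} (λ i → i)))) ⟩
  (3 * L) ^ (n * n) * 6 ^ (n * n * n) ∎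
  where
  open ≡-Reasoning
  square-cost : ∀ {s} → s ∈ squares n → cost L s ≡ 3 * L
  square-cost s∈ with a , b , _ , _ , refl ← ∈-cartesianProductWith⁻ square (allFin n) (allFin n) s∈ = refl
  cube-cost : ∀ {s} → s ∈ cubes n → cost L s ≡ 6
  cube-cost s∈
    with f , c , f∈ , _ , refl ← ∈-cartesianProductWith⁻ (λ f c → f c) (cartesianProductWith cube (allFin n) (allFin n)) (allFin n) s∈
    with a , b , _ , _ , refl ← ∈-cartesianProductWith⁻ cube (allFin n) (allFin n) f∈ = refl
  length-fins² : ∀ {C : Set} (f : Fin n → Fin n → C) → length (cartesianProductWith f (allFin n) (allFin n)) ≡ n * n
  length-fins² f = trans (length-cartesianProductWith f (allFin n) (allFin n))
    (cong₂ _*_ (length-tabulate {n = n} (λ i → i)) (length-tabulate {n = n} (λ i → i)))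

-- The concatenated solutions are distinct tuples of n + n nonzero entries whose product is
-- squarefull and below (N^n + 1)². Hence they all occur in `spannedBelow` at `Y = N ^ n`, whose
-- length is bounded.
rationalSolutions≤ : ∀ N b n .{{_ : NonZero n}} → N < 2 ^ b →
  ∑ (tuples (interval N) n) (λ xs → ∑ (tuples (interval N) n) (λ ys → ⟦ sameSum? xs ys ⟧)) ≤
  (3 * (n * b)) ^ ((n + n) * (n + n)) * 6 ^ ((n + n) * (n + n) * (n + n)) * N ^ n
rationalSolutions≤ N b n N<2^b = begin
  ∑ box (λ xs → ∑ box (λ ys → ⟦ sameSum? xs ys ⟧))
    ≡⟨ ∑-cong box (λ xs → ∑-cong box λ ys → cong₂ (λ s t → ⟦ sameSum? s t ⟧) (take-++ n xs ys) (drop-++ n xs ys)) ⟨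
  ∑ box (λ xs → ∑ box (λ ys → ⟦ good? (xs ++ ys) ⟧))
    ≡⟨ ∑-tuples-+ (interval N) n n (λ z → ⟦ good? z ⟧) ⟨
  ∑ (tuples (interval N) (n + n)) (λ z → ⟦ good? z ⟧)
    ≡⟨ length-filter≡∑ good? (tuples (interval N) (n + n)) ⟨
  length (filter good? (tuples (interval N) (n + n)))
    ≤⟨ Unique-⊆⇒length≤ (filter⁺ good? (tuples-unique (n + n) (interval-unique N))) good⇒spanned ⟩
  length (spannedBelow L ps (N ^ n))
    ≤⟨ length-spannedBelow L ps (N ^ n) ⟩
  product (map (cost L) ps) * N ^ n
    ≡⟨ cong (_* N ^ n) (product-cost L (n + n)) ⟩
  (3 * L) ^ ((n + n) * (n + n)) * 6 ^ ((n + n) * (n + n) * (n + n)) * N ^ n ∎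
  where
  open ≤-Reasoning
  box = tuples (interval N) n
  -- `N < 2 ^ b` gives (N^n + 1)² ≤ 4^(n·b), so this many scales suffice.
  L = n * b
  ps = allPatterns (n + n)

  good? : (z : Vec ℕ (n + n)) → Dec (SameSum (Vec.take n z) (Vec.drop n z))
  good? z = sameSum? (Vec.take n z) (Vec.drop n z)

  N^n<2^L : suc (N ^ n) ≤ 2 ^ L
  N^n<2^L = begin-strict
    N ^ n            <⟨ ^-monoˡ-< n N<2^b ⟩
    (2 ^ b) ^ n      ≡⟨ ^-*-assoc 2 b n ⟩
    2 ^ (b * n)      ≡⟨ cong (2 ^_) (*-comm b n) ⟩
    2 ^ L            ∎

  2^L²≡4^L : 2 ^ L * 2 ^ L ≡ 4 ^ L
  2^L²≡4^L = trans (sym (^-distribˡ-+-* 2 L L)) (trans (cong (2 ^_) (cong (L ℕ.+_) (sym (+-identityʳ L)))) (sym (^-*-assoc 2 2 L)))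

  good⇒spanned : ∀ {z} → z ∈ filter good? (tuples (interval N) (n + n)) → z ∈ spannedBelow L ps (N ^ n)
  good⇒spanned {z} z∈ with z∈box , same ← ∈-filter⁻ good? {xs = tuples (interval N) (n + n)} z∈ =
    spanned⇒∈spannedBelow L (N ^ n)
      (squarefull⇒spanned z (∏≢0 (All.map (proj₁ ∘ ∈-interval⁻) entries))
        (subst (λ z → Squarefull (∏ z)) (take++drop≡id n z) (sameSum⇒squarefull (Vec.take n z) (Vec.drop n z) same)))
      (begin-strict
        ∏ z                            ≤⟨ ∏≤^ (All.map (proj₂ ∘ ∈-interval⁻) entries) ⟩
        N ^ (n + n)                    ≡⟨ ^-distribˡ-+-* N n n ⟩
        N ^ n * N ^ n                  <⟨ *-mono-< (n<1+n (N ^ n)) (n<1+n (N ^ n)) ⟩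
        suc (N ^ n) * suc (N ^ n)      ∎)
      (≤-trans (*-mono-≤ N^n<2^L N^n<2^L) (≤-reflexive 2^L²≡4^L))
    where
    entries = ∈-tuples⁻ (interval N) (n + n) z∈box

-- A lower bound for the logarithm

toℚᵘ-/ : ∀ i n .{{_ : NonZero n}} → ℚ.toℚᵘ (i / n) ℚᵘ.≃ i ℚᵘ./ n
toℚᵘ-/ i (suc n) = ℚ.toℚᵘ-fromℚᵘ (mkℚᵘ i n)

≤ᵘ⇒/-≤ : ∀ i j m n .{{_ : NonZero m}} .{{_ : NonZero n}} → i ℚᵘ./ m ℚᵘ.≤ j ℚᵘ./ n → i / m ℚ.≤ j / n
≤ᵘ⇒/-≤ i j m n le = ℚ.toℚᵘ-cancel-≤
  (ℚᵘ.≤-respˡ-≃ (ℚᵘ.≃-sym (toℚᵘ-/ i m)) (ℚᵘ.≤-respʳ-≃ (ℚᵘ.≃-sym (toℚᵘ-/ j n)) le))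

⌜_⌝ : ℕ → ℚ
⌜ n ⌝ = + n / 1

⌜⌝-+ : ∀ m n → ⌜ m + n ⌝ ≡ ⌜ m ⌝ ℚ.+ ⌜ n ⌝
⌜⌝-+ m n = ℚ.toℚᵘ-injective (begin
  ℚ.toℚᵘ ⌜ m + n ⌝                    ≈⟨ toℚᵘ-/ (+ (m + n)) 1 ⟩
  mkℚᵘ (+ (m + n)) 0                  ≈⟨ *≡* (cong (ℤ._* + 1) (sym (cong₂ ℤ._+_ (ℤ.*-identityʳ (+ m)) (ℤ.*-identityʳ (+ n))))) ⟩
  mkℚᵘ (+ m) 0 ℚᵘ.+ mkℚᵘ (+ n) 0        ≈⟨ ℚᵘ.+-cong (toℚᵘ-/ (+ m) 1) (toℚᵘ-/ (+ n) 1) ⟨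
  ℚ.toℚᵘ ⌜ m ⌝ ℚᵘ.+ ℚ.toℚᵘ ⌜ n ⌝        ≈⟨ ℚ.toℚᵘ-homo-+ ⌜ m ⌝ ⌜ n ⌝ ⟨
  ℚ.toℚᵘ (⌜ m ⌝ ℚ.+ ⌜ n ⌝)              ∎)
  where open ℚᵘ.≃-Reasoning

⌜⌝-* : ∀ m n → ⌜ m * n ⌝ ≡ ⌜ m ⌝ ℚ.* ⌜ n ⌝
⌜⌝-* m n = ℚ.toℚᵘ-injective (begin
  ℚ.toℚᵘ ⌜ m * n ⌝                    ≈⟨ toℚᵘ-/ (+ (m * n)) 1 ⟩
  mkℚᵘ (+ (m * n)) 0                  ≈⟨ *≡* (cong (ℤ._* + 1) (ℤ.pos-* m n)) ⟩
  mkℚᵘ (+ m) 0 ℚᵘ.* mkℚᵘ (+ n) 0        ≈⟨ ℚᵘ.*-cong (toℚᵘ-/ (+ m) 1) (toℚᵘ-/ (+ n) 1) ⟨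
  ℚ.toℚᵘ ⌜ m ⌝ ℚᵘ.* ℚ.toℚᵘ ⌜ n ⌝        ≈⟨ ℚ.toℚᵘ-homo-* ⌜ m ⌝ ⌜ n ⌝ ⟨
  ℚ.toℚᵘ (⌜ m ⌝ ℚ.* ⌜ n ⌝)              ∎)
  where open ℚᵘ.≃-Reasoning

⌜⌝-^ : ∀ m n → ⌜ m ^ n ⌝ ≡ ⌜ m ⌝ ^ℚ n
⌜⌝-^ m zero    = refl
⌜⌝-^ m (suc n) = trans (⌜⌝-* m (m ^ n)) (cong (⌜ m ⌝ ℚ.*_) (⌜⌝-^ m n))

⌜⌝-mono-≤ : ∀ {m n} → m ≤ n → ⌜ m ⌝ ℚ.≤ ⌜ n ⌝
⌜⌝-mono-≤ {m} {n} m≤n = ≤ᵘ⇒/-≤ (+ m) (+ n) 1 1 (*≤* (ℤ.*-monoʳ-≤-nonNeg (+ 1) (ℤ.+≤+ m≤n)))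

⌜⌝-nonNeg : ∀ n → ℚ.NonNegative ⌜ n ⌝
⌜⌝-nonNeg n = ℚ.nonNegative (⌜⌝-mono-≤ {0} {n} z≤n)

⌜⌝-pos : ∀ n .{{_ : NonZero n}} → ℚ.Positive ⌜ n ⌝
⌜⌝-pos (suc n) = ℚ.positive (ℚ.<-≤-trans (ℚ.positive⁻¹ 1ℚ) (⌜⌝-mono-≤ {1} {suc n} (s≤s z≤n)))

⌜n⌝*i/n : ∀ m n .{{_ : NonZero n}} → ⌜ n ⌝ ℚ.* (+ m / n) ≡ ⌜ m ⌝
⌜n⌝*i/n m n@(suc k) = ℚ.toℚᵘ-injective (begin
  ℚ.toℚᵘ (⌜ n ⌝ ℚ.* (+ m / n))                ≈⟨ ℚ.toℚᵘ-homo-* ⌜ n ⌝ (+ m / n) ⟩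
  ℚ.toℚᵘ ⌜ n ⌝ ℚᵘ.* ℚ.toℚᵘ (+ m / n)          ≈⟨ ℚᵘ.*-cong (toℚᵘ-/ (+ n) 1) (toℚᵘ-/ (+ m) n) ⟩
  mkℚᵘ (+ n) 0 ℚᵘ.* mkℚᵘ (+ m) k                ≈⟨ *≡* (trans (cong (ℤ._* + 1) (sym (ℤ.pos-* n m)))
                                                      (trans (sym (ℤ.pos-* (n * m) 1))
                                                      (trans (cong +_ (eq n m)) (ℤ.pos-* m (1 * n))))) ⟩
  mkℚᵘ (+ m) 0                                  ≈⟨ toℚᵘ-/ (+ m) 1 ⟨
  ℚ.toℚᵘ ⌜ m ⌝                                  ∎)
  where
  open ℚᵘ.≃-Reasoning
  eq : ∀ n m → n * m * 1 ≡ m * (1 * n)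
  eq = solve-∀

1/-nonNeg : ∀ n .{{_ : NonZero n}} → ℚ.NonNegative (+ 1 / n)
1/-nonNeg n@(suc _) = ℚ.nonNegative (≤ᵘ⇒/-≤ (+ 0) (+ 1) 1 n (*≤* (ℤ.+≤+ z≤n)))

1/-antimono : ∀ {m n} .{{_ : NonZero m}} .{{_ : NonZero n}} → m ≤ n → + 1 / n ℚ.≤ + 1 / m
1/-antimono {m@(suc _)} {n@(suc _)} m≤n = ≤ᵘ⇒/-≤ (+ 1) (+ 1) n m (*≤* (ℤ.*-monoˡ-≤-nonNeg (+ 1) (ℤ.+≤+ m≤n)))

^ℚ-nonNeg : ∀ q .{{_ : ℚ.NonNegative q}} n → ℚ.NonNegative (q ^ℚ n)
^ℚ-nonNeg q zero    = _
^ℚ-nonNeg q (suc n) = ℚ.nonNeg*nonNeg⇒nonNeg q (q ^ℚ n) {{^ℚ-nonNeg q n}}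

*ℚ-mono-≤ : ∀ {p q r s} .{{_ : ℚ.NonNegative q}} .{{_ : ℚ.NonNegative r}} → p ℚ.≤ q → r ℚ.≤ s → p ℚ.* r ℚ.≤ q ℚ.* s
*ℚ-mono-≤ {q = q} {r} p≤q r≤s = ℚ.≤-trans (ℚ.*-monoʳ-≤-nonNeg r p≤q) (ℚ.*-monoˡ-≤-nonNeg q r≤s)

^ℚ-monoˡ-≤ : ∀ {p q} .{{_ : ℚ.NonNegative p}} .{{_ : ℚ.NonNegative q}} n → p ℚ.≤ q → p ^ℚ n ℚ.≤ q ^ℚ n
^ℚ-monoˡ-≤ zero    p≤q = ℚ.≤-refl
^ℚ-monoˡ-≤ {p} {q} (suc n) p≤q = *ℚ-mono-≤ {p} {q} {p ^ℚ n} {{it}} {{^ℚ-nonNeg p n}} p≤q (^ℚ-monoˡ-≤ n p≤q)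

^ℚ-distrib-* : ∀ p q n → (p ℚ.* q) ^ℚ n ≡ p ^ℚ n ℚ.* q ^ℚ n
^ℚ-distrib-* p q zero    = refl
^ℚ-distrib-* p q (suc n) = trans (cong (p ℚ.* q ℚ.*_) (^ℚ-distrib-* p q n))
  (solve 4 (λ p q a b → p :* q :* (a :* b) := p :* a :* (q :* b)) refl p q (p ^ℚ n) (q ^ℚ n))
  where open +-*-Solver

-- Partial sums of the logarithmic series

module _ (N : ℕ) .{{_ : NonZero N}} where

  open ℚ.≤-Reasoning
  open +-*-Solver

  private
    u r : ℚ
    u = + 1 / N
    r = 1ℚ ℚ.- u

    instance
      u-nonNeg : ℚ.NonNegative u
      u-nonNeg = 1/-nonNeg N

      r-nonNeg : ℚ.NonNegative r
      r-nonNeg = ℚ.nonNegative (begin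
        0ℚ           ≡⟨ ℚ.+-inverseʳ 1ℚ ⟨
        1ℚ ℚ.- 1ℚ    ≤⟨ ℚ.+-monoʳ-≤ 1ℚ (ℚ.neg-antimono-≤ (1/-antimono {1} {N} (>-nonZero⁻¹ N))) ⟩
        1ℚ ℚ.- u     ∎)

    S : ℕ → ℚ
    S = logPartial N

    bernoulli : ∀ j → 1ℚ ℚ.- ⌜ j ⌝ ℚ.* u ℚ.≤ r ^ℚ j
    bernoulli zero    = ℚ.≤-reflexive (cong (λ z → 1ℚ ℚ.- z) (ℚ.*-zeroˡ u))
    bernoulli (suc j) = begin
      1ℚ ℚ.- ⌜ suc j ⌝ ℚ.* u
        ≡⟨ cong (λ z → 1ℚ ℚ.- z ℚ.* u) (⌜⌝-+ 1 j) ⟩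
      1ℚ ℚ.- (1ℚ ℚ.+ ⌜ j ⌝) ℚ.* u
        ≡⟨ ℚ.+-identityʳ _ ⟨
      1ℚ ℚ.- (1ℚ ℚ.+ ⌜ j ⌝) ℚ.* u ℚ.+ 0ℚ
        ≤⟨ ℚ.+-monoʳ-≤ (1ℚ ℚ.- (1ℚ ℚ.+ ⌜ j ⌝) ℚ.* u) (ℚ.nonNegative⁻¹ _ {{ju²-nonNeg}}) ⟩
      1ℚ ℚ.- (1ℚ ℚ.+ ⌜ j ⌝) ℚ.* u ℚ.+ ⌜ j ⌝ ℚ.* u ℚ.* u
        ≡⟨ solve 2 (λ j u → con 1ℚ :- (con 1ℚ :+ j) :* u :+ j :* u :* u := (con 1ℚ :- u) :* (con 1ℚ :- j :* u))
             refl ⌜ j ⌝ u ⟩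
      r ℚ.* (1ℚ ℚ.- ⌜ j ⌝ ℚ.* u)
        ≤⟨ ℚ.*-monoˡ-≤-nonNeg r (bernoulli j) ⟩
      r ℚ.* r ^ℚ j ∎
      where
      ju²-nonNeg : ℚ.NonNegative (⌜ j ⌝ ℚ.* u ℚ.* u)
      ju²-nonNeg = ℚ.nonNeg*nonNeg⇒nonNeg (⌜ j ⌝ ℚ.* u) {{ℚ.nonNeg*nonNeg⇒nonNeg ⌜ j ⌝ {{⌜⌝-nonNeg j}} u}} u

    -- Bernoulli's inequality with j/N ≤ 1/2. Up to index N/2 the terms of the series are thus at
    -- least half the harmonic ones.
    ½≤r^j : ∀ {j} → 2 * j ≤ N → ½ ℚ.≤ r ^ℚ j
    ½≤r^j {j} 2j≤N = begin
      ½                        ≡⟨⟩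
      1ℚ ℚ.- ½                 ≤⟨ ℚ.+-monoʳ-≤ 1ℚ (ℚ.neg-antimono-≤ ju≤½) ⟩
      1ℚ ℚ.- ⌜ j ⌝ ℚ.* u       ≤⟨ bernoulli j ⟩
      r ^ℚ j                   ∎
      where
      ju≤½ : ⌜ j ⌝ ℚ.* u ℚ.≤ ½
      ju≤½ = begin
        ⌜ j ⌝ ℚ.* u                          ≡⟨ solve 2 (λ j u → j :* u := con ½ :* (con ⌜ 2 ⌝ :* j :* u)) refl ⌜ j ⌝ u ⟩
        ½ ℚ.* (⌜ 2 ⌝ ℚ.* ⌜ j ⌝ ℚ.* u)        ≡⟨ cong (λ z → ½ ℚ.* (z ℚ.* u)) (⌜⌝-* 2 j) ⟨
        ½ ℚ.* (⌜ 2 * j ⌝ ℚ.* u)            ≤⟨ ℚ.*-monoˡ-≤-nonNeg ½ (ℚ.*-monoʳ-≤-nonNeg u (⌜⌝-mono-≤ 2j≤N)) ⟩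
        ½ ℚ.* (⌜ N ⌝ ℚ.* u)                  ≡⟨ cong (½ ℚ.*_) (⌜n⌝*i/n 1 N) ⟩
        ½                                    ∎

    S-step : ∀ n → S n ℚ.≤ S (suc n)
    S-step n = ℚ.≤-trans (ℚ.≤-reflexive (sym (ℚ.+-identityʳ (S n)))) (ℚ.+-monoʳ-≤ (S n)
      (ℚ.nonNegative⁻¹ _ {{ℚ.nonNeg*nonNeg⇒nonNeg (r ^ℚ suc n) {{^ℚ-nonNeg r (suc n)}} (+ 1 / suc n) {{1/-nonNeg (suc n)}}}}))

    S-mono : ∀ {m n} → m ≤′ n → S m ℚ.≤ S n
    S-mono ≤′-refl           = ℚ.≤-refl
    S-mono (≤′-step {n} m≤n) = ℚ.≤-trans (S-mono m≤n) (S-step n)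

    -- Each of the `m` added terms has index at most H ≤ N/2 and so is at least 1/(2H).
    S-growth : ∀ m n H .{{_ : NonZero H}} → m + n ≤ H → 2 * H ≤ N →
               S n ℚ.+ ⌜ m ⌝ ℚ.* (½ ℚ.* (+ 1 / H)) ℚ.≤ S (m + n)
    S-growth zero    n H _      _     = ℚ.≤-reflexive (trans (cong (S n ℚ.+_) (ℚ.*-zeroˡ (½ ℚ.* (+ 1 / H)))) (ℚ.+-identityʳ (S n)))
    S-growth (suc m) n H m+n<H 2H≤N = begin
      S n ℚ.+ ⌜ suc m ⌝ ℚ.* h               ≡⟨ cong (λ z → S n ℚ.+ z ℚ.* h) (⌜⌝-+ 1 m) ⟩
      S n ℚ.+ (1ℚ ℚ.+ ⌜ m ⌝) ℚ.* h          ≡⟨ solve 3 (λ s m h → s :+ (con 1ℚ :+ m) :* h := s :+ m :* h :+ h) refl (S n) ⌜ m ⌝ h ⟩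
      S n ℚ.+ ⌜ m ⌝ ℚ.* h ℚ.+ h             ≤⟨ ℚ.+-mono-≤ (S-growth m n H (<⇒≤ m+n<H) 2H≤N)
                                                (*ℚ-mono-≤ {½} {r ^ℚ suc (m + n)} {+ 1 / H} {{^ℚ-nonNeg r (suc (m + n))}} {{1/-nonNeg H}}
                                                  (½≤r^j {suc m + n} (≤-trans (*-monoʳ-≤ 2 m+n<H) 2H≤N)) (1/-antimono m+n<H)) ⟩
      S (suc m + n)                       ∎
      where
      h = ½ ℚ.* (+ 1 / H)

    ¼ : ℚ
    ¼ = + 1 / 4

    -- The dyadic grouping of the harmonic series: doubling the index from 2^i adds 2^i terms of
    -- size at least 1/(4·2^i), together 1/4. The start S 1 ≥ 1/2 accounts for the 2 in `2 + i`.
    S-2^ : ∀ i → 2 * 2 ^ i ≤ N → ¼ ℚ.* ⌜ 2 + i ⌝ ℚ.≤ S (2 ^ i)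
    S-2^ zero    2≤N = begin
      ½                              ≡⟨⟩
      0ℚ ℚ.+ 1ℚ ℚ.* (½ ℚ.* 1ℚ)       ≤⟨ S-growth 1 0 1 ≤-refl 2≤N ⟩
      S 1                            ∎
    S-2^ (suc i) 2^≤N = begin
      ¼ ℚ.* ⌜ 3 + i ⌝                              ≡⟨ cong (¼ ℚ.*_) (⌜⌝-+ 1 (2 + i)) ⟩
      ¼ ℚ.* (1ℚ ℚ.+ ⌜ 2 + i ⌝)                     ≡⟨ solve 1 (λ x → con ¼ :* (con 1ℚ :+ x) := con ¼ :* x :+ con ¼) refl ⌜ 2 + i ⌝ ⟩
      ¼ ℚ.* ⌜ 2 + i ⌝ ℚ.+ ¼                        ≤⟨ ℚ.+-monoˡ-≤ ¼ (S-2^ i (≤-trans (*-monoʳ-≤ 2 (m≤n*m (2 ^ i) 2)) 2^≤N)) ⟩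
      S h ℚ.+ ¼                                      ≡⟨ cong (S h ℚ.+_) quarter ⟨
      S h ℚ.+ ⌜ h ⌝ ℚ.* (½ ℚ.* (+ 1 / H))          ≤⟨ S-growth h h H (≤-reflexive (cong (h ℕ.+_) (sym (+-identityʳ h)))) 2^≤N ⟩
      S (h + h)                                    ≡⟨ cong (λ z → S (h + z)) (+-identityʳ h) ⟨
      S H                                            ∎
      where
      h = 2 ^ i
      H = 2 ^ suc i
      instance
        H≢0 : NonZero H
        H≢0 = m^n≢0 2 (suc i)
      quarter : ⌜ h ⌝ ℚ.* (½ ℚ.* (+ 1 / H)) ≡ ¼
      quarter = begin-equality
        ⌜ h ⌝ ℚ.* (½ ℚ.* (+ 1 / H))            ≡⟨ solve 2 (λ h v → h :* (con ½ :* v) := con ¼ :* (con ⌜ 2 ⌝ :* h :* v)) refl ⌜ h ⌝ (+ 1 / H) ⟩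
        ¼ ℚ.* (⌜ 2 ⌝ ℚ.* ⌜ h ⌝ ℚ.* (+ 1 / H))  ≡⟨ cong (λ z → ¼ ℚ.* (z ℚ.* (+ 1 / H))) (⌜⌝-* 2 h) ⟨
        ¼ ℚ.* (⌜ H ⌝ ℚ.* (+ 1 / H))            ≡⟨ cong (¼ ℚ.*_) (⌜n⌝*i/n 1 H) ⟩
        ¼                                        ∎

  -- For `N < 2 ^ (2 + b)` this bounds the exponent `2 + b` by four times the logarithm. It passes
  -- from index 2^b to all later ones because the partial sums increase.
  log-lower : ∀ b → 2 ^ suc b ≤ N → ∀ n → 2 ^ b ≤ n → ⌜ 2 + b ⌝ ℚ.≤ ⌜ 4 ⌝ ℚ.* logPartial N n
  log-lower b 2^≤N n 2^b≤n = begin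
    ⌜ 2 + b ⌝                      ≡⟨ solve 1 (λ x → x := con ⌜ 4 ⌝ :* (con ¼ :* x)) refl ⌜ 2 + b ⌝ ⟩
    ⌜ 4 ⌝ ℚ.* (¼ ℚ.* ⌜ 2 + b ⌝)    ≤⟨ ℚ.*-monoˡ-≤-nonNeg ⌜ 4 ⌝ (ℚ.≤-trans (S-2^ b 2^≤N) (S-mono (≤⇒≤′ 2^b≤n))) ⟩
    ⌜ 4 ⌝ ℚ.* S n                    ∎

-- Comparison of the constants

^-distribʳ-* : ∀ m n o → (m * n) ^ o ≡ m ^ o * n ^ o
^-distribʳ-* m n zero    = refl
^-distribʳ-* m n (suc o) = trans (cong (m * n *_) (^-distribʳ-* m n o)) (eq m n (m ^ o) (n ^ o))
  where
  eq : ∀ a b c d → a * b * (c * d) ≡ a * c * (b * d)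
  eq = solve-∀

n<2^n : ∀ n → n < 2 ^ n
n<2^n zero    = s≤s z≤n
n<2^n (suc n) = begin-strict
  suc n             ≤⟨ n<2^n n ⟩
  2 ^ n             <⟨ m<m*n (2 ^ n) 2 {{m^n≢0 2 n}} (s≤s (s≤s z≤n)) ⟩
  2 ^ n * 2         ≡⟨ *-comm (2 ^ n) 2 ⟩
  2 ^ suc n         ∎
  where open ≤-Reasoning

-- `b` is one less than the integer part of the binary logarithm, which is at least 1 since `2 ≤ N`.
⌊log₂⌋ : ∀ N → 2 ≤ N → ∃[ b ] 2 ^ suc b ≤ N × N < 2 ^ (2 + b)
⌊log₂⌋ N 2≤N with log-floor 2 N {{>-nonZero (<⇒≤ 2≤N)}} (n<2^n N)
... | zero  , _ , _  , hi = contradiction hi (≤⇒≯ 2≤N)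
... | suc b , _ , lo , hi = b , lo , hi

-- Everything is compared with powers of d = 2k ≥ 2: 6 ≤ d³ and 12k = 6d ≤ d⁴. The total exponent 1
-- + 16k² + 24k³ is at most 41k³.
constant-bound : ∀ k .{{_ : NonZero k}} → 2 * k * ((12 * k) ^ (4 * k ^ 2) * 6 ^ (8 * k ^ 3)) ≤ (2 * k) ^ (90 * k ^ 3)
constant-bound k = begin
  d * ((12 * k) ^ (4 * k ^ 2) * 6 ^ (8 * k ^ 3))
    ≤⟨ *-monoʳ-≤ d (*-mono-≤ (^-monoˡ-≤ (4 * k ^ 2) 12k≤d⁴) (^-monoˡ-≤ (8 * k ^ 3) 6≤d³)) ⟩
  d * ((d ^ 4) ^ (4 * k ^ 2) * (d ^ 3) ^ (8 * k ^ 3))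
    ≡⟨ cong (d *_) (cong₂ _*_ (^-*-assoc d 4 (4 * k ^ 2)) (^-*-assoc d 3 (8 * k ^ 3))) ⟩
  d * (d ^ (4 * (4 * k ^ 2)) * d ^ (3 * (8 * k ^ 3)))
    ≡⟨ cong (d *_) (^-distribˡ-+-* d (4 * (4 * k ^ 2)) (3 * (8 * k ^ 3))) ⟨
  d ^ suc (4 * (4 * k ^ 2) + 3 * (8 * k ^ 3))
    ≤⟨ ^-monoʳ-≤ d {{m*n≢0 2 k}} exponent ⟩
  d ^ (90 * k ^ 3) ∎
  where
  open ≤-Reasoning
  d = 2 * k

  8≤d³ : 8 ≤ d ^ 3
  8≤d³ = ^-monoˡ-≤ 3 (*-monoʳ-≤ 2 (>-nonZero⁻¹ k))

  6≤d³ : 6 ≤ d ^ 3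
  6≤d³ = ≤-trans (m≤m+n 6 2) 8≤d³

  12k≤d⁴ : 12 * k ≤ d ^ 4
  12k≤d⁴ = begin
    12 * k         ≡⟨ trans (*-assoc 6 2 k) (*-comm 6 d) ⟩
    d * 6          ≤⟨ *-monoʳ-≤ d 6≤d³ ⟩
    d ^ 4          ∎

  exponent : suc (4 * (4 * k ^ 2) + 3 * (8 * k ^ 3)) ≤ 90 * k ^ 3
  exponent = begin
    1 + (4 * (4 * k ^ 2) + 3 * (8 * k ^ 3))
      ≤⟨ +-mono-≤ (m^n>0 k 3) (+-monoˡ-≤ (3 * (8 * k ^ 3)) (*-monoʳ-≤ 4 (*-monoʳ-≤ 4 (^-monoʳ-≤ k (m≤m+n 2 1))))) ⟩
    k ^ 3 + (4 * (4 * k ^ 3) + 3 * (8 * k ^ 3))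
      ≡⟨ eq (k ^ 3) ⟩
    41 * k ^ 3
      ≤⟨ *-monoˡ-≤ (k ^ 3) (m≤m+n 41 49) ⟩
    90 * k ^ 3 ∎
    where
    eq : ∀ c → c + (4 * (4 * c) + 3 * (8 * c)) ≡ 41 * c
    eq = solve-∀

-- The estimate over ℕ with denominators cleared: `p` for N^(2k-1)/p, and 4^(4k²) for the later
-- replacement of `W` by 4 log N. The `suc` provides the strict inequality.
solutions-bound : ∀ {p} .{{_ : NonZero p}} → Prime p → ∀ k .{{_ : NonZero k}} N .{{_ : NonZero N}} W → N < p → N < 2 ^ W →
  p * 4 ^ (4 * k ^ 2) * suc (J₂ₖ p N k) ≤
  (2 * k) ^ (90 * k ^ 3) * W ^ (4 * k ^ 2) * N ^ k * (p + N ^ (2 * k ∸ 1))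
solutions-bound {p} pr k@(suc k-1) N zero    N<p N<2^W = contradiction N<2^W (≤⇒≯ (>-nonZero⁻¹ N))
solutions-bound {p} pr k@(suc k-1) N W@(suc _) N<p N<2^W = begin
  p * 4 ^ e * suc (J₂ₖ p N k)
    ≤⟨ *-monoʳ-≤ (p * 4 ^ e) (s≤s (≤-trans (J₂ₖ≤rationalSolutions pr N<p k-1) (*-monoʳ-≤ R rational))) ⟩
  p * 4 ^ e * suc (R * C)
    -- The added 1 is absorbed by `R * C ≥ 1`, at the price of a factor 2.
    ≤⟨ *-monoʳ-≤ (p * 4 ^ e) (+-monoˡ-≤ (R * C) (>-nonZero⁻¹ (R * C) {{m*n≢0 R C {{_}} {{C≢0}}}})) ⟩
  p * 4 ^ e * (R * C + R * C)
    ≡⟨ eq₁ p (4 ^ e) R C ⟩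
  p * R * (2 * (4 ^ e * C))
    ≤⟨ *-monoˡ-≤ (2 * (4 ^ e * C)) pR≤ ⟩
  k * (p + N ^ (2 * k ∸ 1)) * (2 * (4 ^ e * C))
    ≡⟨ cong (λ c → k * (p + N ^ (2 * k ∸ 1)) * (2 * (4 ^ e * (c * 6 ^ f * N ^ k))))
         (trans (cong (_^ e) (eq₂ k W)) (^-distribʳ-* (3 * k) W e)) ⟩
  k * (p + N ^ (2 * k ∸ 1)) * (2 * (4 ^ e * ((3 * k) ^ e * W ^ e * 6 ^ f * N ^ k)))
    ≡⟨ eq₃ k (p + N ^ (2 * k ∸ 1)) (4 ^ e) ((3 * k) ^ e) (W ^ e) (6 ^ f) (N ^ k) ⟩
  2 * k * (4 ^ e * (3 * k) ^ e * 6 ^ f) * W ^ e * N ^ k * (p + N ^ (2 * k ∸ 1))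
    ≡⟨ cong (λ c → 2 * k * (c * 6 ^ f) * W ^ e * N ^ k * (p + N ^ (2 * k ∸ 1)))
         (trans (sym (^-distribʳ-* 4 (3 * k) e)) (cong (_^ e) (sym (*-assoc 4 3 k)))) ⟩
  2 * k * ((12 * k) ^ e * 6 ^ f) * W ^ e * N ^ k * (p + N ^ (2 * k ∸ 1))
    ≤⟨ *-monoˡ-≤ (p + N ^ (2 * k ∸ 1)) (*-monoˡ-≤ (N ^ k) (*-monoˡ-≤ (W ^ e) (constant-bound k))) ⟩
  (2 * k) ^ (90 * k ^ 3) * W ^ e * N ^ k * (p + N ^ (2 * k ∸ 1)) ∎
  where
  open ≤-Reasoning
  e = 4 * k ^ 2
  f = 8 * k ^ 3
  X = k * N ^ k-1 * N ^ k
  R = suc (X /ℕ p)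
  C = (3 * (k * W)) ^ e * 6 ^ f * N ^ k

  C≢0 : NonZero C
  C≢0 = m*n≢0 _ (N ^ k) {{m*n≢0 _ (6 ^ f) {{m^n≢0 (3 * (k * W)) e}} {{m^n≢0 6 f}}}} {{m^n≢0 N k}}

  rational : _ ≤ C
  rational = ≤-trans (rationalSolutions≤ N W k N<2^W)
    (≤-reflexive (cong₂ (λ a b → (3 * (k * W)) ^ a * 6 ^ b * N ^ k) (eq-e k) (eq-f k)))
    where
    eq-e : ∀ k → (k + k) * (k + k) ≡ 4 * (k * (k * 1))
    eq-e = solve-∀
    eq-f : ∀ k → (k + k) * (k + k) * (k + k) ≡ 8 * (k * (k * (k * 1)))
    eq-f = solve-∀

  -- The `k` pulled out here stems from the bound k·N^(k-1) for numerators; with the factor 2 above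
  -- it forms the leading `2 * k` in `constant-bound`.
  pR≤ : p * R ≤ k * (p + N ^ (2 * k ∸ 1))
  pR≤ = begin
    p * suc (X /ℕ p)                          ≡⟨ *-suc p (X /ℕ p) ⟩
    p + p * (X /ℕ p)                          ≡⟨ cong (p ℕ.+_) (*-comm p (X /ℕ p)) ⟩
    p + X /ℕ p * p                            ≤⟨ +-monoʳ-≤ p (m/n*n≤m X p) ⟩
    p + k * N ^ k-1 * N ^ k                  ≡⟨ cong (p ℕ.+_) (trans (*-assoc k (N ^ k-1) (N ^ k)) (cong (k *_) (sym (^-distribˡ-+-* N k-1 k)))) ⟩
    p + k * N ^ (k-1 + k)                    ≤⟨ +-monoˡ-≤ _ (m≤n*m p k) ⟩
    k * p + k * N ^ (k-1 + k)                ≡⟨ *-distribˡ-+ k p _ ⟨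
    k * (p + N ^ (k-1 + k))                  ≡⟨ cong (λ z → k * (p + N ^ (k-1 + z))) (+-identityʳ k) ⟨
    k * (p + N ^ (2 * k ∸ 1))                ∎

  eq₁ : ∀ p a r c → p * a * (r * c + r * c) ≡ p * r * (2 * (a * c))
  eq₁ = solve-∀
  eq₂ : ∀ k w → 3 * (k * w) ≡ 3 * k * w
  eq₂ = solve-∀
  eq₃ : ∀ k q a b w s n → k * q * (2 * (a * (b * w * s * n))) ≡ 2 * k * (a * b * s) * w * n * q
  eq₃ = solve-∀

-- Passage to real numbers

seq-^ℝ : ∀ x e n → seq (x ^ℝ e) n ≡ seq x n ^ℚ e
seq-^ℝ x zero    n = refl
seq-^ℝ x (suc e) n = cong (seq x n ℚ.*_) (seq-^ℝ x e n)

-- The common factor `p * 4 ^ e` cancels, since W^e ≤ 4^e·l^e and p + X = p·(X/p + 1).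
scaled-bound : ∀ p .{{_ : NonZero p}} J A W e Y X l → ⌜ W ⌝ ℚ.≤ ⌜ 4 ⌝ ℚ.* l →
  p * 4 ^ e * suc J ≤ A * W ^ e * Y * (p + X) →
  ⌜ J ⌝ ℚ.+ 1ℚ ℚ.≤ ⌜ A ⌝ ℚ.* l ^ℚ e ℚ.* (+ X / p ℚ.+ 1ℚ) ℚ.* ⌜ Y ⌝
scaled-bound p J A W e Y X l W≤4l bound = ℚ.*-cancelˡ-≤-pos ⌜ c ⌝ {{⌜⌝-pos c {{c≢0}}}} (begin
  ⌜ c ⌝ ℚ.* (⌜ J ⌝ ℚ.+ 1ℚ)
    ≡⟨ cong (⌜ c ⌝ ℚ.*_) (trans (ℚ.+-comm ⌜ J ⌝ 1ℚ) (sym (⌜⌝-+ 1 J))) ⟩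
  ⌜ c ⌝ ℚ.* ⌜ suc J ⌝
    ≡⟨ ⌜⌝-* c (suc J) ⟨
  ⌜ c * suc J ⌝
    ≤⟨ ⌜⌝-mono-≤ bound ⟩
  ⌜ A * W ^ e * Y * (p + X) ⌝
    ≡⟨ trans (⌜⌝-* (A * W ^ e * Y) (p + X)) (cong (ℚ._* ⌜ p + X ⌝)
         (trans (⌜⌝-* (A * W ^ e) Y) (cong (ℚ._* ⌜ Y ⌝) (trans (⌜⌝-* A (W ^ e)) (cong (⌜ A ⌝ ℚ.*_) (⌜⌝-^ W e)))))) ⟩
  ⌜ A ⌝ ℚ.* ⌜ W ⌝ ^ℚ e ℚ.* ⌜ Y ⌝ ℚ.* ⌜ p + X ⌝
    ≤⟨ ℚ.*-monoʳ-≤-nonNeg ⌜ p + X ⌝ {{⌜⌝-nonNeg (p + X)}} (ℚ.*-monoʳ-≤-nonNeg ⌜ Y ⌝ {{⌜⌝-nonNeg Y}}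
         (ℚ.*-monoˡ-≤-nonNeg ⌜ A ⌝ {{⌜⌝-nonNeg A}} (^ℚ-monoˡ-≤ {{⌜⌝-nonNeg W}} {{4l-nonNeg}} e W≤4l))) ⟩
  ⌜ A ⌝ ℚ.* (⌜ 4 ⌝ ℚ.* l) ^ℚ e ℚ.* ⌜ Y ⌝ ℚ.* ⌜ p + X ⌝
    ≡⟨ cong₂ (λ a b → ⌜ A ⌝ ℚ.* a ℚ.* ⌜ Y ⌝ ℚ.* b) (trans (^ℚ-distrib-* ⌜ 4 ⌝ l e) (cong (ℚ._* l ^ℚ e) (sym (⌜⌝-^ 4 e))))
         (trans (⌜⌝-+ p X) (cong (⌜ p ⌝ ℚ.+_) (sym (⌜n⌝*i/n X p)))) ⟩
  ⌜ A ⌝ ℚ.* (⌜ 4 ^ e ⌝ ℚ.* l ^ℚ e) ℚ.* ⌜ Y ⌝ ℚ.* (⌜ p ⌝ ℚ.+ ⌜ p ⌝ ℚ.* q)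
    ≡⟨ solve 6 (λ A f l Y p q → A :* (f :* l) :* Y :* (p :+ p :* q) := p :* f :* (A :* l :* (q :+ con 1ℚ) :* Y))
         refl ⌜ A ⌝ ⌜ 4 ^ e ⌝ (l ^ℚ e) ⌜ Y ⌝ ⌜ p ⌝ q ⟩
  ⌜ p ⌝ ℚ.* ⌜ 4 ^ e ⌝ ℚ.* (⌜ A ⌝ ℚ.* l ^ℚ e ℚ.* (q ℚ.+ 1ℚ) ℚ.* ⌜ Y ⌝)
    ≡⟨ cong (ℚ._* (⌜ A ⌝ ℚ.* l ^ℚ e ℚ.* (q ℚ.+ 1ℚ) ℚ.* ⌜ Y ⌝)) (⌜⌝-* p (4 ^ e)) ⟨
  ⌜ c ⌝ ℚ.* (⌜ A ⌝ ℚ.* l ^ℚ e ℚ.* (q ℚ.+ 1ℚ) ℚ.* ⌜ Y ⌝) ∎)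
  where
  open ℚ.≤-Reasoning
  open +-*-Solver
  c = p * 4 ^ e
  q = + X / p
  c≢0 = m*n≢0 p (4 ^ e) {{it}} {{m^n≢0 4 e}}
  4l-nonNeg = ℚ.nonNegative (ℚ.≤-trans (ℚ.nonNegative⁻¹ ⌜ W ⌝ {{⌜⌝-nonNeg W}}) W≤4l)

theorem5 : ∃[ p₀ ] (∀ (p : ℕ) .{{_ : NonZero p}} → Prime p → p₀ ≤ p →
    ∀ (k : ℕ) .{{_ : NonZero k}} (N : ℕ) .{{_ : NonZero N}} → 2 ≤ N → N < p →
    fromℕ (J₂ₖ p N k)
    <ℝ fromℕ ((2 * k) ^ (90 * k ^ 3))
    *ℝ log N ^ℝ (4 * k ^ 2)
    *ℝ fromℚ (+ (N ^ (2 * k ∸ 1)) / p +ℚ 1ℚ)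
    *ℝ fromℕ (N ^ k))
theorem5 = 0 , λ p pr _ k N 2≤N N<p →
  let b , 2^[1+b]≤N , N<2^[2+b] = ⌊log₂⌋ N 2≤N in
  -- The gap 1 is the one in `suc (J₂ₖ p N k)`, and `2 ^ b` is the index from which `log-lower`
  -- holds.
  1ℚ , ℚ.positive⁻¹ 1ℚ , 2 ^ b , λ n 2^b≤n →
    subst (λ z → ⌜ J₂ₖ p N k ⌝ +ℚ 1ℚ ℚ.≤
                 ⌜ (2 * k) ^ (90 * k ^ 3) ⌝ ℚ.* z ℚ.* (+ (N ^ (2 * k ∸ 1)) / p +ℚ 1ℚ) ℚ.* ⌜ N ^ k ⌝)
      (sym (seq-^ℝ (log N) (4 * k ^ 2) n))
      (scaled-bound p (J₂ₖ p N k) ((2 * k) ^ (90 * k ^ 3)) (2 + b) (4 * k ^ 2) (N ^ k) (N ^ (2 * k ∸ 1)) (logPartial N n)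
        (log-lower N b 2^[1+b]≤N n 2^b≤n) (solutions-bound pr k N (2 + b) N<p N<2^[2+b]))
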